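{- Let $H$ be a graph. There is an algorithm that, given any $H$-graph $G$ on $n\geq 2$ vertices, an $H$-representation of $G$ and the corresponding subdivision of $H$, computes in polynomial time a caterpillar decomposition $(T,\delta)$ of $G$ with $\operatorname{mim}(T,\delta)\leq \max\{1,2\|H\|\}$.
   Context: All graphs are finite, undirected, loopless, and may have multiple edges. $|G|$ and $\|G\|$ denote the numbers of vertices and of edges (counted with multiplicity) of $G$. For $X\subseteq V(G)$, $\overline{X}=V(G)\setminus X$, and for disjoint $X,Y\subseteq V(G)$, $G[X,Y]$ is the bipartite subgraph of $G$ with vertex set $X\cup Y$ whose edges are the edges of $G$ with one endpoint in $X$ and the other in $Y$. Let $H$ be a (multi)graph. A graph $G$ is an $H$-graph if there are a subdivision $H'$ of $H$ (obtained by placing vertices of degree 2 on edges) and a collection $\mathcal{M}=\{M_v\}_{v\in V(G)}$ (an $H$-representation of $G$) of non-empty subsets of $V(H')$, each inducing a connected subgraph of $H'$, such that $G$ is (isomorphic to) the intersection graph of $\mathcal{M}$, i.e. distinct $u,v$ are adjacent in $G$ iff $M_u\cap M_v\neq\emptyset$. A branch decomposition of $G$ is a pair $(T,\delta)$ where $T$ is a full binary rooted tree (that is, every non-leaf vertex has degree 3) and $\delta$ is a bijection from the leaves of $T$ to $V(G)$. It is a caterpillar decomposition if $T$ can be obtained from a path by adding, for every internal vertex of the path, a vertex of degree one adjacent to it. For $w\in V(T)$, $V_w$ is the set of vertices of $G$ in bijection (via $\delta$) with the leaves of the subtree of $T$ rooted at $w$. An induced matching of a graph is a set of vertices inducing a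 disjoint union of edges. $\operatorname{mim}(X)$, for $X\subseteq V(G)$, is the maximum number of edges in an induced matching of $G[X,\overline{X}]$, and $\operatorname{mim}(T,\delta)$ is the maximum of $\operatorname{mim}(V_w)$ over all $w\in V(T)$. -}

module Defs where

open import Data.Bool using (if_then_else_)
open import Data.Fin using (Fin; zero; suc; toℕ; inject₁)
open import Data.Fin.Properties using (_≟_; any?; all?)
open import Data.Fin.Subset using (Subset; inside; outside; _∈_; _∉_; _∩_; Nonempty)
open import Data.Fin.Subset.Properties using (_∈?_)
open import Data.List using (List; []; _∷_; _++_; [_]; map; filter; length; lookup; concat; tabulate; allFin)
open import Data.List.Extrema.Nat using (max)
open import Data.List.Membership.Propositional using () renaming (_∈_ to _∈ˡ_)
open import Data.List.Membership.Propositional.Properties using (∈-lookup; ∈-tabulate⁻)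
open import Data.List.Relation.Unary.All as All using (All; []; _∷_)
import Data.List.Relation.Unary.All.Properties as All
open import Data.List.Relation.Unary.Any using (here)
open import Data.List.Relation.Unary.AllPairs using ([]; _∷_)
open import Data.List.Relation.Unary.Unique.Propositional using (Unique)
import Data.List.Relation.Unary.Unique.Propositional.Properties as Unique
open import Data.Nat using (ℕ; zero; suc; _+_; _*_; _∸_; _^_; _≤_)
import Data.Nat as ℕ
open import Data.Nat.GeneralisedArithmetic using (fold)
open import Data.Product using (Σ; ∃; ∃-syntax; _×_; _,_; proj₁; proj₂; uncurry)
open import Data.Sum using (_⊎_; inj₁; inj₂)
open import Data.Sum.Properties using (inj₁-injective)
import Data.Vec as Vec
open import Function using (_∘_; _⇔_; _⤖_; _↔_; case_of_; Bijection; Inverse)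
open import Relation.Binary using (Decidable)
open import Relation.Binary.Construct.Closure.ReflexiveTransitive using (Star)
open import Relation.Binary.PropositionalEquality using (_≡_; _≢_; refl)
open import Relation.Nullary using (¬_; Dec; does; ¬?; _×-dec_; _⊎-dec_; _→-dec_)
import Relation.Unary as U

------------------------------------------------------------------------
-- Multigraphs

Edge : ℕ → Set
Edge n = Fin n × Fin n

-- Each list entry is one undirected edge, so parallel edges are repeated
-- entries; the order of the two components is immaterial.
record Graph : Set where
  field
    order    : ℕ
    edges    : List (Edge order)
    loopless : All (uncurry _≢_) edges

  Vertex : Set
  Vertex = Fin order

open Graph public using (Vertex)

∣_∣ : Graph → ℕ
∣ G ∣ = Graph.order G

‖_‖ : Graph → ℕ
‖ G ‖ = length (Graph.edges G)

Adj : (G : Graph) → Vertex G → Vertex G → Set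
Adj G u v = (u , v) ∈ˡ Graph.edges G ⊎ (v , u) ∈ˡ Graph.edges G

source target : (G : Graph) → Fin ‖ G ‖ → Vertex G
source G e = proj₁ (lookup (Graph.edges G) e)
target G e = proj₂ (lookup (Graph.edges G) e)

ends-≢ : ∀ G e → source G e ≢ target G e
ends-≢ G e = All.lookup (Graph.loopless G) (∈-lookup e)

Incident : ∀ {n} → Fin n → Edge n → Set
Incident v (a , b) = v ≡ a ⊎ v ≡ b

incident? : ∀ {n} (v : Fin n) → U.Decidable (Incident v)
incident? v (a , b) = (v ≟ a) ⊎-dec (v ≟ b)

degree : (G : Graph) → Vertex G → ℕ
degree G v = length (filter (incident? v) (Graph.edges G))

keepEdges : (G : Graph) {P : Edge ∣ G ∣ → Set} → U.Decidable P → Graph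
keepEdges G P? = record
  { order    = ∣ G ∣
  ; edges    = filter P? (Graph.edges G)
  ; loopless = All.filter⁺ P? (Graph.loopless G)
  }

------------------------------------------------------------------------
-- Maximum induced matchings across a cut

Crosses : ∀ {n} → Subset n → Edge n → Set
Crosses X (a , b) = (a ∈ X × b ∉ X) ⊎ (a ∉ X × b ∈ X)

crosses? : ∀ {n} (X : Subset n) → U.Decidable (Crosses X)
crosses? X (a , b) =
  ((a ∈? X) ×-dec ¬? (b ∈? X)) ⊎-dec (¬? (a ∈? X) ×-dec (b ∈? X))

-- G[X, V(G) ∖ X]
cut : (G : Graph) → Subset ∣ G ∣ → Graph
cut G X = keepEdges G (crosses? X)

Within : ∀ {n} → Subset n → Edge n → Set
Within S (a , b) = a ∈ S × b ∈ S

within? : ∀ {n} (S : Subset n) → U.Decidable (Within S)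
within? S (a , b) = (a ∈? S) ×-dec (b ∈? S)

-- The subgraph induced by S, together with the vertices outside S as
-- isolated vertices.
induced : (G : Graph) → Subset ∣ G ∣ → Graph
induced G S = keepEdges G (within? S)

-- S induces a disjoint union of edges, i.e. a 1-regular graph.
IsInducedMatching : (G : Graph) → Subset ∣ G ∣ → Set
IsInducedMatching G S = ∀ v → v ∈ S → degree (induced G S) v ≡ 1

isInducedMatching? : (G : Graph) → U.Decidable (IsInducedMatching G)
isInducedMatching? G S =
  all? λ v → (v ∈? S) →-dec (degree (induced G S) v ℕ.≟ 1)

subsets : ∀ n → List (Subset n)
subsets zero    = [ Vec.[] ]
subsets (suc n) =
  map (outside Vec.∷_) (subsets n) ++ map (inside Vec.∷_) (subsets n)

mim : (G : Graph) → Subset ∣ G ∣ → ℕ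
mim G X = max 0 (map (λ S → ‖ induced B S ‖)
                     (filter (isInducedMatching? B) (subsets ∣ G ∣)))
  where B = cut G X

------------------------------------------------------------------------
-- Subdivisions

steps : ∀ {A : Set} → List A → List (A × A)
steps (x ∷ y ∷ zs) = (x , y) ∷ steps (y ∷ zs)
steps _            = []

steps-≢ : ∀ {A : Set} {xs : List A} → Unique xs → All (uncurry _≢_) (steps xs)
steps-≢ []                      = []
steps-≢ (_ ∷ [])                = []
steps-≢ ((x≢y ∷ _) ∷ u@(_ ∷ _)) = x≢y ∷ steps-≢ u

-- The e-th edge of H is replaced by a path with `len e` new inner vertices.
-- The vertices of the result may be numbered in any way.
record Subdivision (H : Graph) : Set where
  field
    order    : ℕ
    len      : Fin ‖ H ‖ → ℕ
    vertices : (Vertex H ⊎ Σ (Fin ‖ H ‖) (Fin ∘ len)) ⤖ Fin order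

  branch : Vertex H → Fin order
  branch v = Bijection.to vertices (inj₁ v)

  inner : (e : Fin ‖ H ‖) → Fin (len e) → Fin order
  inner e i = Bijection.to vertices (inj₂ (e , i))

  path : Fin ‖ H ‖ → List (Fin order)
  path e = map (Bijection.to vertices)
    (inj₁ (source H e) ∷ tabulate (λ i → inj₂ (e , i)) ++ [ inj₁ (target H e) ])

  path-unique : ∀ e → Unique (path e)
  path-unique e = Unique.map⁺ (Bijection.injective vertices)
    ( All.++⁺ (All.tabulate⁺ λ _ ()) ((λ { eq → ends-≢ H e (inj₁-injective eq) }) ∷ [])
    ∷ Unique.++⁺ (Unique.tabulate⁺ λ { refl → refl }) ([] ∷ [])
        λ { (p , here refl) → case ∈-tabulate⁻ p of λ { (_ , ()) } })

  graph : Graph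
  graph = record
    { order    = order
    ; edges    = concat (map (steps ∘ path) (allFin ‖ H ‖))
    ; loopless = All.concat⁺ (All.map⁺ (All.tabulate⁺ λ e → steps-≢ (path-unique e)))
    }

------------------------------------------------------------------------
-- H-representations

ConnectedIn : (G : Graph) → Subset ∣ G ∣ → Set
ConnectedIn G S = ∀ {a b} → a ∈ S → b ∈ S →
  Star (λ x y → Adj G x y × x ∈ S × y ∈ S) a b

record Representation {H : Graph} (G : Graph) (H′ : Subdivision H) : Set where
  private module H′ = Subdivision H′
  field
    bag           : Vertex G → Subset ∣ H′.graph ∣
    bag-nonempty  : ∀ v → Nonempty (bag v)
    bag-connected : ∀ v → ConnectedIn H′.graph (bag v)
    adj⇔meet      : ∀ u v → u ≢ v → Adj G u v ⇔ Nonempty (bag u ∩ bag v)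

record Instance (H : Graph) : Set where
  field
    G    : Graph
    H′   : Subdivision H
    repr : Representation G H′

  open Subdivision H′ public hiding (order)
  open Representation repr public

------------------------------------------------------------------------
-- Rooted trees and branch decompositions

-- Non-root vertices are joined to their parents.  A vertex has fewer than
-- `size` proper ancestors, so k < size reaches all of them.
record RootedTree : Set where
  field
    size   : ℕ
    root   : Fin size
    parent : Fin size → Fin size

  Node : Set
  Node = Fin size

  Ancestor : Node → Node → Set
  Ancestor w v = ∃[ k ] fold v parent (toℕ {size} k) ≡ w

  ancestor? : Decidable Ancestor
  ancestor? w v = any? λ k → fold v parent (toℕ k) ≟ w

  field
    parent-root  : parent root ≡ root
    root-reached : ∀ v → Ancestor root v

  _~_ : Node → Node → Set
  u ~ v = u ≢ v × (parent u ≡ v ⊎ parent v ≡ u)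

  _~?_ : Decidable _~_
  u ~? v = ¬? (u ≟ v) ×-dec ((parent u ≟ v) ⊎-dec (parent v ≟ u))

  treeDegree : Node → ℕ
  treeDegree v = length (filter (v ~?_) (allFin size))

  Leaf : Node → Set
  Leaf v = treeDegree v ≡ 1

record BranchDecomposition (G : Graph) : Set where
  field
    tree : RootedTree

  open RootedTree tree public

  field
    full-binary : ∀ v → ¬ Leaf v → treeDegree v ≡ 3
    δ           : ∃ Leaf ↔ Vertex G

  below : Node → Subset ∣ G ∣
  below w = Vec.tabulate λ u → does (ancestor? w (proj₁ (Inverse.from δ u)))

mimT : ∀ {G} → BranchDecomposition G → ℕ
mimT {G} D = max 0 (map (λ w → mim G (below w)) (allFin size))
  where open BranchDecomposition D

-- A path with k + 2 vertices (inj₁), and one pendant vertex (inj₂) for each of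
-- its k internal vertices.
data Link (k : ℕ) : (x y : Fin (suc (suc k)) ⊎ Fin k) → Set where
  along : (i : Fin (suc k)) → Link k (inj₁ (inject₁ i)) (inj₁ (suc i))
  hang  : (i : Fin k) → Link k (inj₁ (suc (inject₁ i))) (inj₂ i)

record IsCaterpillar (T : RootedTree) : Set where
  open RootedTree T
  field
    k     : ℕ
    nodes : (Fin (suc (suc k)) ⊎ Fin k) ⤖ Node

  node : Fin (suc (suc k)) ⊎ Fin k → Node
  node = Bijection.to nodes

  field
    links : ∀ x y → (node x ~ node y) ⇔ (Link k x y ⊎ Link k y x)

------------------------------------------------------------------------
-- Random access machine programs

-- Memory consists of two-dimensional arrays of natural numbers, named by
-- natural numbers.  A program mentions only finitely many arrays.
Name : Set
Name = ℕ

Store : Set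
Store = Name → ℕ → ℕ → ℕ

infixl 6 _⊕_ _⊖_

data Expr : Set where
  lit     : ℕ → Expr
  _⟨_,_⟩  : Name → Expr → Expr → Expr
  _⊕_ _⊖_ : Expr → Expr → Expr

⟦_⟧ : Expr → Store → ℕ
⟦ lit x ⟧         s = x
⟦ a ⟨ e , f ⟩ ⟧   s = s a (⟦ e ⟧ s) (⟦ f ⟧ s)
⟦ e ⊕ f ⟧         s = ⟦ e ⟧ s + ⟦ f ⟧ s
⟦ e ⊖ f ⟧         s = ⟦ e ⟧ s ∸ ⟦ f ⟧ s

infixr 4 _⨟_
infix  5 _⟨_,_⟩≔_

data Program : Set where
  skip          : Program
  _⟨_,_⟩≔_      : Name → Expr → Expr → Expr → Program
  _⨟_           : Program → Program → Program
  ifnz_then_else_ : Expr → Program → Program → Program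
  while_loop_   : Expr → Program → Program

write : Store → Name → ℕ → ℕ → ℕ → Store
write s a i j x a′ i′ j′ =
  if does ((a′ ℕ.≟ a) ×-dec (i′ ℕ.≟ i) ×-dec (j′ ℕ.≟ j)) then x else s a′ i′ j′

-- Run p s t s′: started in s, program p halts in s′ after t steps.  Guards
-- hold when nonzero.  Every assignment, skip and test counts as one step; this
-- is the usual unit-cost measure, which is polynomially related to Turing
-- machine time because the only arithmetic is addition and truncated
-- subtraction, so that t steps lengthen numbers by O(t) bits only.
data Run : Program → Store → ℕ → Store → Set where
  skip   : ∀ {s} → Run skip s 1 s
  assign : ∀ {a e f g s} →
           Run (a ⟨ e , f ⟩≔ g) s 1 (write s a (⟦ e ⟧ s) (⟦ f ⟧ s) (⟦ g ⟧ s))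
  seq    : ∀ {p q s s′ s″ t t′} →
           Run p s t s′ → Run q s′ t′ s″ → Run (p ⨟ q) s (t + t′) s″
  then′  : ∀ {e p q s s′ t} → ⟦ e ⟧ s ≢ 0 →
           Run p s t s′ → Run (ifnz e then p else q) s (suc t) s′
  else′  : ∀ {e p q s s′ t} → ⟦ e ⟧ s ≡ 0 →
           Run q s t s′ → Run (ifnz e then p else q) s (suc t) s′
  stop   : ∀ {e p s} → ⟦ e ⟧ s ≡ 0 → Run (while e loop p) s 1 s
  again  : ∀ {e p s s′ s″ t t′} → ⟦ e ⟧ s ≢ 0 →
           Run p s t s′ → Run (while e loop p) s′ t′ s″ →
           Run (while e loop p) s (suc (t + t′)) s″

SolvesInPolynomialTime : {I : Set} → Program →
  (input : I → Store) (size : I → ℕ)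
  (Pre : I → Set) (Post : I → Store → Set) → Set
SolvesInPolynomialTime p input size Pre Post =
  ∃[ c ] ∃[ d ] (∀ x → Pre x →
    ∃[ t ] ∃[ s ] (Run p (input x) t s × t ≤ c * suc (size x) ^ d × Post x s))

------------------------------------------------------------------------
-- Input and output conventions

pattern orderG     = 0
pattern sizeG      = 1
pattern edgesG     = 2
pattern orderH′    = 3
pattern sizeH′     = 4
pattern edgesH′    = 5
pattern branchH′   = 6
pattern lenH′      = 7
pattern innerH′    = 8
pattern bags       = 9

treeSize treeRoot treeParent leafVertex : Name
treeSize   = 10
treeRoot   = 11
treeParent = 12
leafVertex = 13

-- Cells outside the given range hold 0.
array : ∀ {n} → (Fin n → ℕ) → ℕ → ℕ
array {zero}  f i       = 0
array {suc n} f zero    = f zero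
array {suc n} f (suc i) = array (f ∘ suc) i

array₂ : ∀ {n} {m : Fin n → ℕ} → ((i : Fin n) → Fin (m i) → ℕ) → ℕ → ℕ → ℕ
array₂ f i j = array (λ i′ → array (f i′) j) i

scalar : ℕ → ℕ → ℕ → ℕ
scalar x zero zero = x
scalar x _    _    = 0

column : ∀ {n} → (Fin n → ℕ) → ℕ → ℕ → ℕ
column f i zero    = array f i
column f i (suc _) = 0

edgeArray : (G : Graph) → ℕ → ℕ → ℕ
edgeArray G i zero          = array (toℕ ∘ source G) i
edgeArray G i (suc zero)    = array (toℕ ∘ target G) i
edgeArray G i (suc (suc _)) = 0

module _ {H : Graph} (I : Instance H) where
  open Instance I

  input : Store
  input orderG   = scalar ∣ G ∣
  input sizeG    = scalar ‖ G ‖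
  input edgesG   = edgeArray G
  input orderH′  = scalar ∣ graph ∣
  input sizeH′   = scalar ‖ graph ‖
  input edgesH′  = edgeArray graph
  input branchH′ = column (toℕ ∘ branch)
  input lenH′    = column len
  input innerH′  = array₂ (λ e i → toℕ (inner e i))
  input bags     = array₂ {m = λ _ → ∣ graph ∣} (λ v x → if does (x ∈? bag v) then 1 else 0)
  input _        = λ _ _ → 0

  inputSize : ℕ
  inputSize = ∣ G ∣ + ‖ G ‖ + ∣ graph ∣ + ‖ graph ‖

record Outputs {G : Graph} (s : Store) (D : BranchDecomposition G) : Set where
  open BranchDecomposition D
  field
    size-written   : s treeSize 0 0 ≡ size
    root-written   : s treeRoot 0 0 ≡ toℕ root
    parent-written : ∀ v → s treeParent (toℕ v) 0 ≡ toℕ (parent v)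
    δ-written      : ∀ v (ℓ : Leaf v) →
                     s leafVertex (toℕ v) 0 ≡ toℕ (Inverse.to δ (v , ℓ))

{-# OPTIONS --safe #-}

-- The vertices of H′ are ordered with the isolated vertices of H first, then
-- the remaining vertices of H, then the inner vertices, path by path; G is
-- ordered by the first vertex of H′ in each bag.  Let X be a prefix and let xy
-- be an edge of an induced matching across the cut, x ∈ X.  Inside the bag of x,
-- walk along a path e of H′ from a vertex shared with y to an end of e, or, if
-- the bag is an interval in the interior of e, towards its first vertex.  This
-- assigns to xy one of the 2‖H‖ pairs (edge of H, direction).  If two matching
-- edges got the same pair, the nearer of the two shared vertices would lie in
-- both x-bags, giving a forbidden adjacency.  Isolated vertices of H admit no
-- such pair, but a matching that uses one has a single edge.
module Submission where

open import Defs
open import Data.Bool using (if_then_else_)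
open import Data.Empty using (⊥)
open import Data.Fin using (Fin; zero; suc; toℕ; inject₁; fromℕ; fromℕ<; join; splitAt; combine)
open import Data.Fin.Properties using (_≟_; any?; toℕ<n; toℕ≤pred[n]; toℕ-injective; toℕ-inject₁; toℕ-fromℕ; toℕ-fromℕ<; toℕ-↑ˡ; toℕ-↑ʳ; splitAt-join; join-splitAt; inject₁-injective; fromℕ≢inject₁; injective⇒≤; combine-injective) renaming (suc-injective to Fin-suc-injective)
open import Data.Fin.Relation.Unary.Top using (view; view-fromℕ; view-inject₁; ‵fromℕ; ‵inject₁)
open import Data.Fin.Subset using (Subset; _∈_; _∉_)
open import Data.Fin.Subset.Properties using (_∈?_; x∈p∩q⁺; x∈p∩q⁻)
open import Data.List using (List; []; _∷_; _++_; [_]; map; filter; length; lookup; tabulate; allFin)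
open import Data.List.Extrema.Nat using (max; max≤v⁺)
import Data.List.Membership.DecPropositional as DecMembership
open import Data.List.Membership.Propositional using () renaming (_∈_ to _∈ˡ_; _∉_ to _∉ˡ_)
open import Data.List.Membership.Propositional.Properties using (∈-lookup; ∈-filter⁺; ∈-filter⁻; ∈-concat⁻′; ∈-allFin; ∈-map⁺; ∈-map⁻; ∈-++⁺ˡ; ∈-++⁺ʳ)
open import Data.List.Membership.Propositional.Properties.WithK using (unique∧set⇒bag)
open import Data.List.Properties using (length-map)
open import Data.List.Relation.Binary.BagAndSetEquality using (∼bag⇒↭)
open import Data.List.Relation.Binary.Permutation.Propositional.Properties using (↭-length)
open import Data.List.Relation.Unary.All as All using (All; []; _∷_)
import Data.List.Relation.Unary.All.Properties as All
open import Data.List.Relation.Unary.AllPairs using (AllPairs; []; _∷_)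
import Data.List.Relation.Unary.AllPairs.Properties as AllPairs
open import Data.List.Relation.Unary.Any using (here; there; index)
open import Data.List.Relation.Unary.Any.Properties using (lookup-index)
open import Data.List.Relation.Unary.Unique.Propositional using (Unique)
import Data.List.Relation.Unary.Unique.Propositional.Properties as Unique
open import Data.Nat using (ℕ; zero; suc; _+_; _*_; _∸_; _^_; _≤_; _<_; _⊔_; z≤n; s≤s; _≤?_)
import Data.Nat as ℕ
open import Data.Nat.GeneralisedArithmetic using (fold)
open import Data.Nat.Properties using (*-assoc; *-comm; *-distribʳ-+; *-identityʳ; *-identityˡ; *-mono-≤; *-monoʳ-≤; +-cancelˡ-≡; +-comm; +-identityʳ; +-mono-≤; +-monoʳ-≤; +-monoˡ-≤; +-suc; 0∸n≡0; <-irrefl; <⇒≢; <⇒≤; <⇒≯; <⇒≱; >⇒≢; m+[n∸m]≡n; m>n⇒m∸n≢0; m∸n+n≡m; m≤m+n; m≤m⊔n; m≤n+m; m≤n⇒m<n∨m≡n; m≤n⇒m≤1+n; m≤n⊔m; n∸n≡0; n≤1+n; suc-injective; ≡-irrelevant; ≤-<-trans; ≤-antisym; ≤-pred; ≤-refl; ≤-reflexive; ≤-total; ≤-trans; ≤∧≢⇒<; ≮⇒≥; ≰⇒>)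
open import Data.Product using (Σ; ∃; ∃-syntax; _×_; _,_; proj₁; proj₂)
open import Data.Sum using (_⊎_; inj₁; inj₂; [_,_]′; swap)
open import Data.Sum.Properties using (inj₁-injective)
open import Data.Unit using (⊤; tt)
import Data.Vec as Vec
open import Data.Vec.Properties using (lookup∘tabulate; lookup⇒[]=; []=⇒lookup)
open import Function using (_∘_; _↔_; Bijection; Equivalence; Inverse; case_of_; mk⇔; mk⤖; mk↔ₛ′)
open import Relation.Binary.Construct.Closure.ReflexiveTransitive using (Star; ε; _◅_)
open import Relation.Binary.PropositionalEquality using (_≡_; _≢_; refl; sym; trans; cong; cong₂; subst)
open import Relation.Nullary using (¬_; does; yes; no; ¬?; _×-dec_; _⊎-dec_; contradiction)
open import Relation.Nullary.Decidable using (dec-true; dec-false)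
open import Relation.Unary using (Decidable)

-- Induced matchings across prefixes of the order

-- The two directions are not symmetric. A walk that ends inside `e` at the first vertex of the bag
-- of x has run towards the source, and in general it stops short of it. The missing part of the
-- segment is harmless because x precedes every vertex outside the prefix: no bag outside the prefix
-- meets `e` before that first vertex. A second shared vertex with the same pair therefore cannot
-- fall into the gap.
--
-- Isolated vertices are visited first because a matching edge living on one could otherwise be
-- added to a matching that already uses all pairs.
--
-- The caterpillar is rooted at one end of its path. The subtree of a path vertex then yields a
-- prefix of the order, and that of a pendant vertex yields a single vertex. Singleton cuts, and
-- matchings with a single edge, account for the 1 in the maximum.
--
-- Since `H` is fixed, only the lengths of the subdivided edges and the order of `G` vary. Each
-- vertex of the subdivision causes one scan over the vertices of `G`, which gives a quadratic
-- bound.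

max-≤ : ∀ {A : Set} (f : A → ℕ) {b} {xs : List A} → All (λ x → f x ≤ b) xs → max 0 (map f xs) ≤ b
max-≤ f fx≤b = max≤v⁺ z≤n (All.map⁺ fx≤b)

-- Positions are compared rather than entries: parallel edges are equal entries at different
-- positions.
filter-length≡1 : ∀ {A : Set} {P : A → Set} (P? : Decidable P) (xs : List A) →
                  length (filter P? xs) ≡ 1 →
                  ∀ i j → P (lookup xs i) → P (lookup xs j) → i ≡ j
filter-length≡1 P? (x ∷ xs) ≡1 i j Pi Pj with P? x
filter-length≡1 P? (x ∷ xs) ≡1 zero zero Pi Pj | _ = refl
filter-length≡1 P? (x ∷ xs) ≡1 zero (suc j) Pi Pj | no ¬Px = contradiction Pi ¬Px
filter-length≡1 P? (x ∷ xs) ≡1 (suc i) zero Pi Pj | no ¬Px = contradiction Pj ¬Px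
filter-length≡1 P? (x ∷ xs) ≡1 (suc i) (suc j) Pi Pj | no _ = cong suc (filter-length≡1 P? xs ≡1 i j Pi Pj)
filter-length≡1 P? (x ∷ xs) ≡1 (suc i) j Pi Pj | yes _
  with filter P? xs | ∈-filter⁺ P? (∈-lookup {xs = xs} i) Pi
filter-length≡1 P? (x ∷ xs) ≡1 (suc i) j Pi Pj | yes _ | _ ∷ _ | _ = case ≡1 of λ ()
filter-length≡1 P? (x ∷ xs) ≡1 zero (suc j) Pi Pj | yes _
  with filter P? xs | ∈-filter⁺ P? (∈-lookup {xs = xs} j) Pj
... | _ ∷ _ | _ = case ≡1 of λ ()

-- Adjacencies inside either side are left free because the cut graph discards them. Between the
-- sides, adjacency in `G` and in the cut graph agree.
record InducedMatching (G : Graph) (X : Subset ∣ G ∣) (m : ℕ) : Set where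
  field
    x y     : Fin m → Vertex G
    x∈      : ∀ i → x i ∈ X
    y∉      : ∀ i → y i ∉ X
    matched : ∀ i → Adj G (x i) (y i)
    only    : ∀ i j → Adj G (x i) (y j) → i ≡ j

module _ (G : Graph) (X : Subset ∣ G ∣) where

  inducedMatching : ∀ S → IsInducedMatching (cut G X) S →
                    InducedMatching G X ‖ induced (cut G X) S ‖
  inducedMatching S isIM = record
    { x = x′ ; y = y′ ; x∈ = x∈′ ; y∉ = y∉′ ; matched = adj ; only = ind }
    where
    E = Graph.edges (induced (cut G X) S)

    ∈E⁺ : ∀ {e} → e ∈ˡ Graph.edges G → Crosses X e → Within S e → e ∈ˡ E
    ∈E⁺ e∈G cr wi = ∈-filter⁺ (within? S) (∈-filter⁺ (crosses? X) e∈G cr) wi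

    Oriented : Edge ∣ G ∣ → Set
    Oriented e = ∃[ x ] ∃[ y ] (x ∈ X × y ∉ X × x ∈ S × y ∈ S × Adj G x y × Incident x e × Incident y e)

    orient : ∀ e → e ∈ˡ E → Oriented e
    orient e e∈E with ∈-filter⁻ (within? S) {xs = Graph.edges (cut G X)} e∈E
    ... | e∈cut , a∈S , b∈S with ∈-filter⁻ (crosses? X) {xs = Graph.edges G} e∈cut
    ... | e∈G , inj₁ (a∈X , b∉X) = _ , _ , a∈X , b∉X , a∈S , b∈S , inj₁ e∈G , inj₁ refl , inj₂ refl
    ... | e∈G , inj₂ (a∉X , b∈X) = _ , _ , b∈X , a∉X , b∈S , a∈S , inj₂ e∈G , inj₂ refl , inj₁ refl

    o : ∀ i → Oriented (lookup E i)
    o i = orient (lookup E i) (∈-lookup {xs = E} i)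

    x′ y′ : Fin (length E) → Vertex G
    x′ i = proj₁ (o i)
    y′ i = proj₁ (proj₂ (o i))
    x∈′ : ∀ i → x′ i ∈ X
    x∈′ i = proj₁ (proj₂ (proj₂ (o i)))
    y∉′ : ∀ i → y′ i ∉ X
    y∉′ i = proj₁ (proj₂ (proj₂ (proj₂ (o i))))
    x∈S : ∀ i → x′ i ∈ S
    x∈S i = proj₁ (proj₂ (proj₂ (proj₂ (proj₂ (o i)))))
    y∈S : ∀ i → y′ i ∈ S
    y∈S i = proj₁ (proj₂ (proj₂ (proj₂ (proj₂ (proj₂ (o i))))))
    adj : ∀ i → Adj G (x′ i) (y′ i)
    adj i = proj₁ (proj₂ (proj₂ (proj₂ (proj₂ (proj₂ (proj₂ (o i)))))))
    x-end : ∀ i → Incident (x′ i) (lookup E i)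
    x-end i = proj₁ (proj₂ (proj₂ (proj₂ (proj₂ (proj₂ (proj₂ (proj₂ (o i))))))))
    y-end : ∀ i → Incident (y′ i) (lookup E i)
    y-end i = proj₂ (proj₂ (proj₂ (proj₂ (proj₂ (proj₂ (proj₂ (proj₂ (o i))))))))

    unique-edge : ∀ {v} → v ∈ S → ∀ i j → Incident v (lookup E i) → Incident v (lookup E j) → i ≡ j
    unique-edge {v} v∈S = filter-length≡1 (incident? v) E (isIM v v∈S)

    -- An edge of the matching through both `x′ i` and `y′ j` is the only one at either vertex, so
    -- it is the i-th and the j-th edge.
    common : ∀ i j {e} → e ∈ˡ E → Incident (x′ i) e → Incident (y′ j) e → i ≡ j
    common i j e∈E xe ye = trans
      (unique-edge (x∈S i) i (index e∈E) (x-end i) (subst (Incident _) (lookup-index e∈E) xe))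
      (unique-edge (y∈S j) (index e∈E) j (subst (Incident _) (lookup-index e∈E) ye) (y-end j))

    ind : ∀ i j → Adj G (x′ i) (y′ j) → i ≡ j
    ind i j (inj₁ xy∈G) = common i j (∈E⁺ xy∈G (inj₁ (x∈′ i , y∉′ j)) (x∈S i , y∈S j)) (inj₁ refl) (inj₂ refl)
    ind i j (inj₂ yx∈G) = common i j (∈E⁺ yx∈G (inj₂ (y∉′ j , x∈′ i)) (y∈S j , x∈S i)) (inj₂ refl) (inj₁ refl)

  mim-≤ : ∀ {b} → (∀ {m} → InducedMatching G X m → m ≤ b) → mim G X ≤ b
  mim-≤ ≤b = max-≤ (λ S → ‖ induced (cut G X) S ‖)
    (All.map (λ {S} isIM → ≤b (inducedMatching S isIM))
      (All.all-filter (isInducedMatching? (cut G X)) (subsets ∣ G ∣)))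

  mim-singleton-≤1 : (∀ {u v} → u ∈ X → v ∈ X → u ≡ v) → mim G X ≤ 1
  mim-singleton-≤1 u≡v = mim-≤ λ M → let open InducedMatching M in
    -- All edges of the matching share their end in `X`, so `only` identifies any two of them.
    injective⇒≤ {f = λ _ → zero {0}} λ {i} {j} _ →
      InducedMatching.only M i j (subst (λ u → Adj G u (y j)) (u≡v (x∈ j) (x∈ i)) (matched j))

-- Positions along a subdivided edge

data At {A : Set} {n} (x : A) (g : Fin n → A) (y : A) : ℕ → A → Set where
  first : At x g y 0 x
  mid   : ∀ i → At x g y (suc (toℕ i)) (g i)
  last  : At x g y (suc n) y

At-suc : ∀ {A : Set} {n} {x : A} {g : Fin (suc n) → A} {y p z} → At (g zero) (g ∘ suc) y p z → At x g y (suc p) z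
At-suc first   = mid zero
At-suc (mid i) = mid (suc i)
At-suc last    = last

At-functional : ∀ {A : Set} {n} {x y : A} {g : Fin n → A} {p z w} → At x g y p z → At x g y p w → z ≡ w
-- Two indices of the form `suc (toℕ i)` do not unify, so `go` takes separate indices and an
-- equation between them.
At-functional = λ u v → go u v refl
  where
  go : ∀ {A : Set} {n} {x y : A} {g : Fin n → A} {p q z w} → At x g y p z → At x g y q w → p ≡ q → z ≡ w
  go first   first   _  = refl
  go {g = g} (mid i) (mid j) eq = cong g (toℕ-injective (suc-injective eq))
  go (mid i) last    eq = contradiction (toℕ<n i) (<-irrefl (suc-injective eq))
  go last    (mid j) eq = contradiction (toℕ<n j) (<-irrefl (suc-injective (sym eq)))
  go last    last    _  = refl

At-≤ : ∀ {A : Set} {n} {x y : A} {g : Fin n → A} {p z} → At x g y p z → p ≤ suc n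
At-≤ first   = z≤n
At-≤ (mid i) = s≤s (<⇒≤ (toℕ<n i))
At-≤ last    = ≤-refl

steps-At : ∀ {A : Set} {n} (x : A) (g : Fin n → A) y {a b} → (a , b) ∈ˡ steps (x ∷ tabulate g ++ [ y ]) →
           ∃[ p ] (At x g y p a × At x g y (suc p) b)
steps-At {n = zero}  x g y (here refl) = 0 , first , last
steps-At {n = suc n} x g y (here refl) = 0 , first , mid zero
steps-At {n = suc n} x g y (there ab∈) =
  let p , atA , atB = steps-At (g zero) (g ∘ suc) y ab∈ in suc p , At-suc atA , At-suc atB

steps-map⁻ : ∀ {A B : Set} (f : A → B) xs {a b} → (a , b) ∈ˡ steps (map f xs) →
             ∃[ a′ ] ∃[ b′ ] (a ≡ f a′ × b ≡ f b′ × (a′ , b′) ∈ˡ steps xs)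
steps-map⁻ f (x ∷ y ∷ zs) (here refl) = x , y , refl , refl , here refl
steps-map⁻ f (x ∷ y ∷ zs) (there ab∈) =
  let a′ , b′ , a≡ , b≡ , ab′∈ = steps-map⁻ f (y ∷ zs) ab∈ in a′ , b′ , a≡ , b≡ , there ab′∈

-- The order on the vertices of the subdivision

module Order (H : Graph) (len : Fin ‖ H ‖ → ℕ) where

  V′ : Set
  V′ = Vertex H ⊎ Σ (Fin ‖ H ‖) (Fin ∘ len)

  Touches : Vertex H → Fin ‖ H ‖ → Set
  Touches b e = b ≡ source H e ⊎ b ≡ target H e

  Isolated : Vertex H → Set
  Isolated b = ¬ ∃ (Touches b)

  touched? : Decidable (λ b → ∃ (Touches b))
  touched? b = any? λ e → (b ≟ source H e) ⊎-dec (b ≟ target H e)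

  -- The first clause makes isolated vertices precede all others, and orders them
  -- strictly; no order is imposed among the other vertices of H.
  _≼_ : V′ → V′ → Set
  inj₁ b       ≼ inj₁ b′       = Isolated b′ → Isolated b × toℕ b ≤ toℕ b′
  inj₁ b       ≼ inj₂ _        = ⊤
  inj₂ _       ≼ inj₁ _        = ⊥
  inj₂ (e , i) ≼ inj₂ (e′ , j) = toℕ e ≤ toℕ e′ × (e ≡ e′ → toℕ i ≤ toℕ j)

-- Charging matching edges to pairs of an edge of H and a direction

module Cuts {H : Graph} (I : Instance H) where
  open Instance I
  open Order H len public

  to : V′ → Fin (Subdivision.order H′)
  to = Bijection.to vertices

  _∋_ : Vertex G → V′ → Set
  v ∋ z = to z ∈ bag v

  -- This is what the moment of placing x at z provides: the bags of x and of any y still unplaced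
  -- contain only vertices not yet visited, and z is the least of these.
  Prec : Vertex G → Vertex G → Set
  Prec x y = ∃[ z ] (x ∋ z × (∀ w → x ∋ w ⊎ y ∋ w → z ≼ w))

  Pos : Fin ‖ H ‖ → ℕ → V′ → Set
  Pos e = At (inj₁ (source H e)) (λ i → inj₂ (e , i)) (inj₁ (target H e))

  Next : V′ → V′ → Set
  Next z w = ∃[ e ] ∃[ p ] (Pos e p z × Pos e (suc p) w)

  edge-Next : ∀ {z w} → (to z , to w) ∈ˡ Graph.edges graph → Next z w
  edge-Next zw∈ with ∈-concat⁻′ (map (steps ∘ path) (allFin ‖ H ‖)) zw∈
  ... | _ , zw∈xs , xs∈ with ∈-map⁻ (steps ∘ path) xs∈
  ... | e , _ , refl with steps-map⁻ to _ zw∈xs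
  ... | z′ , w′ , z≡ , w≡ , zw′∈ with Bijection.injective vertices z≡ | Bijection.injective vertices w≡
  ... | refl | refl = e , steps-At _ _ _ zw′∈

  Step : (V′ → Set) → V′ → V′ → Set
  Step S z w = (Next z w ⊎ Next w z) × S z × S w

  bag-walk : ∀ v {z w} → v ∋ z → v ∋ w → Star (Step (v ∋_)) z w
  bag-walk v z∈ w∈ = convert (bag-connected v z∈ w∈) refl refl
    where
    convert : ∀ {z w a b} → Star (λ x y → Adj graph x y × x ∈ bag v × y ∈ bag v) a b →
              a ≡ to z → b ≡ to w → Star (Step (v ∋_)) z w
    convert ε a≡ b≡ with Bijection.injective vertices (trans (sym a≡) b≡)
    ... | refl = ε
    convert (_◅_ {j = c} (adj , a∈ , c∈) walk) refl b≡ with Bijection.surjective vertices c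
    ... | w , to≡ with to≡ refl
    ... | refl = ([ inj₁ ∘ edge-Next , inj₂ ∘ edge-Next ]′ adj , a∈ , c∈) ◅ convert walk refl b≡

  Pos-inner : ∀ {e p e′ i} → Pos e p (inj₂ (e′ , i)) → e ≡ e′ × p ≡ suc (toℕ i)
  Pos-inner (mid i) = refl , refl

  Pos-branch : ∀ {e p b} → Pos e p (inj₁ b) → Touches b e
  Pos-branch first = inj₁ refl
  Pos-branch last  = inj₂ refl

  Cover : Fin ‖ H ‖ → (V′ → Set) → (ℕ → Set) → Set
  Cover e S A = ∀ {t w} → A t → Pos e t w → S w

  grow : ∀ {e S A p z} (B : ℕ → Set) → Pos e p z → S z → (∀ {t} → B t → t ≡ p ⊎ A t) →
         Cover e S A → Cover e S B
  grow {S = S} B pos Sz split cover Bt pos′ with split Bt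
  ... | inj₁ refl = subst S (At-functional pos pos′) Sz
  ... | inj₂ At   = cover At pos′

  Between : ℕ → ℕ → ℕ → Set
  Between p r t = (p ≤ t × t ≤ r) ⊎ (r ≤ t × t ≤ p)

  -- Three fates of a walk in `S` from position `p`: it reaches the source, it reaches the target,
  -- or it ends at `d` while still on `e`. The walk is cut off at its first visit to an end, and the
  -- segment swept until then lies in `S`.
  WalkOutcome : Fin ‖ H ‖ → (V′ → Set) → ℕ → V′ → Set
  WalkOutcome e S p d =
    Cover e S (_≤ p) ⊎ Cover e S (p ≤_) ⊎ ∃[ r ] (Pos e r d × Cover e S (Between p r))

  -- Whichever way the step goes, the segment demanded from `p` is contained in the one covered from
  -- `p′` together with `p` itself.
  grow-outcome : ∀ {e S p p′ z d} → Pos e p z → S z → p′ ≡ suc p ⊎ p ≡ suc p′ →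
                 WalkOutcome e S p′ d → WalkOutcome e S p d
  grow-outcome {p = p} pos Sz (inj₁ refl) (inj₁ cover) =
    inj₁ (grow (_≤ p) pos Sz (λ t≤ → inj₂ (≤-trans t≤ (n≤1+n _))) cover)
  grow-outcome {p = p} pos Sz (inj₂ refl) (inj₁ cover) =
    inj₁ (grow (_≤ p) pos Sz (λ t≤ → [ (λ { (s≤s t<) → inj₂ t< }) , inj₁ ]′ (m≤n⇒m<n∨m≡n t≤)) cover)
  grow-outcome {p = p} pos Sz (inj₁ refl) (inj₂ (inj₁ cover)) =
    inj₂ (inj₁ (grow (p ≤_) pos Sz (λ p≤ → [ inj₂ , inj₁ ∘ sym ]′ (m≤n⇒m<n∨m≡n p≤)) cover))
  grow-outcome {p = p} pos Sz (inj₂ refl) (inj₂ (inj₁ cover)) =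
    inj₂ (inj₁ (grow (p ≤_) pos Sz (λ p≤ → inj₂ (≤-trans (n≤1+n _) p≤)) cover))
  grow-outcome {p = p} pos Sz near (inj₂ (inj₂ (r , posr , cover))) =
    inj₂ (inj₂ (r , posr , grow (Between p r) pos Sz (split near) cover))
    where
    split : ∀ {p′ t} → p′ ≡ suc p ⊎ p ≡ suc p′ → Between p r t → t ≡ p ⊎ Between p′ r t
    split (inj₁ refl) (inj₁ (p≤t , t≤r)) =
      [ (λ p<t → inj₂ (inj₁ (p<t , t≤r))) , inj₁ ∘ sym ]′ (m≤n⇒m<n∨m≡n p≤t)
    split (inj₂ refl) (inj₁ (p≤t , t≤r)) = inj₂ (inj₁ (≤-trans (n≤1+n _) p≤t , t≤r))
    split (inj₁ refl) (inj₂ (r≤t , t≤p)) = inj₂ (inj₂ (r≤t , ≤-trans t≤p (n≤1+n _)))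
    split (inj₂ refl) (inj₂ (r≤t , t≤p)) =
      [ (λ { (s≤s t≤p′) → inj₂ (inj₂ (r≤t , t≤p′)) }) , inj₁ ]′ (m≤n⇒m<n∨m≡n t≤p)

  walk-outcome : ∀ {e S p z d} → Pos e p z → S z → Star (Step S) z d → WalkOutcome e S p d
  walk-outcome {S = S} pos Sz ε = inj₂ (inj₂ (_ , pos , at-p))
    where
    at-p : Cover _ S (Between _ _)
    at-p (inj₁ (p≤t , t≤p)) pos′ with ≤-antisym p≤t t≤p
    ... | refl = subst S (At-functional pos pos′) Sz
    at-p (inj₂ (p≤t , t≤p)) pos′ with ≤-antisym p≤t t≤p
    ... | refl = subst S (At-functional pos pos′) Sz
  -- At an end the walk may continue onto another path, but the outcome is already decided.
  walk-outcome {S = S} first Sz (_ ◅ _) =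
    inj₁ λ { z≤n pos′ → subst S (At-functional first pos′) Sz }
  walk-outcome {S = S} last Sz (_ ◅ _) =
    inj₂ (inj₁ λ { p≤t pos′ → case ≤-antisym p≤t (At-≤ pos′) of λ { refl → subst S (At-functional last pos′) Sz } })
  walk-outcome pos@(mid i) Sz ((inj₁ (e′ , q , posz , posw) , _ , Sw) ◅ walk) with Pos-inner posz
  ... | refl , refl = grow-outcome pos Sz (inj₁ refl) (walk-outcome posw Sw walk)
  walk-outcome pos@(mid i) Sz ((inj₂ (e′ , q , posw , posz) , _ , Sw) ◅ walk) with Pos-inner posz
  ... | refl , refl = grow-outcome pos Sz (inj₂ refl) (walk-outcome posw Sw walk)

  isolated-walk : ∀ {S b d} → Isolated b → Star (Step S) (inj₁ b) d → d ≡ inj₁ b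
  isolated-walk iso ε = refl
  isolated-walk iso ((inj₁ (e , _ , pos , _) , _) ◅ _) = contradiction (e , Pos-branch pos) iso
  isolated-walk iso ((inj₂ (e , _ , _ , pos) , _) ◅ _) = contradiction (e , Pos-branch pos) iso

  module _ (X : Subset ∣ G ∣) (ordered : ∀ {x y} → x ∈ X → y ∉ X → Prec x y) where

    record Left (e : Fin ‖ H ‖) (x y : Vertex G) : Set where
      field
        {a p}   : ℕ
        {z}     : V′
        pos     : Pos e p z
        y∋z     : y ∋ z
        x∋      : Cover e (x ∋_) (λ t → a ≤ t × t ≤ p)
        -- For two left charges at e, this puts the nearer shared position into
        -- both covered segments.
        a-least : ∀ {y′ q w} → y′ ∉ X → q < a → Pos e q w → ¬ y′ ∋ w

    record Right (e : Fin ‖ H ‖) (x y : Vertex G) : Set where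
      field
        {p} : ℕ
        {z} : V′
        pos : Pos e p z
        y∋z : y ∋ z
        x∋  : Cover e (x ∋_) (p ≤_)

    Charge : Vertex G → Vertex G → Set
    Charge x y = (∃[ e ] Left e x y) ⊎ (∃[ e ] Right e x y)

    -- A bag containing an isolated vertex of H is a singleton by connectedness.
    LonelyAt : Vertex H → Vertex G → Vertex G → Set
    LonelyAt b x y = Isolated b × x ∋ inj₁ b × y ∋ inj₁ b × (∀ {w} → x ∋ w ⊎ y ∋ w → w ≡ inj₁ b)

    charge : ∀ {x y c} → x ∈ X → y ∉ X → x ∋ c → y ∋ c → Charge x y ⊎ ∃[ b ] LonelyAt b x y
    charge {c = inj₁ b} x∈ y∉ x∋c y∋c with touched? b
    -- The shared vertex is itself an end of `e`, so the segment is a single position.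
    ... | yes (e , inj₁ refl) = inj₁ (inj₁ (e , record
          { a = 0 ; pos = first ; y∋z = y∋c ; a-least = λ _ ()
          ; x∋ = λ { (_ , z≤n) pos′ → subst (_ ∋_) (At-functional first pos′) x∋c } }))
    ... | yes (e , inj₂ refl) = inj₁ (inj₂ (e , record
          { pos = last ; y∋z = y∋c
          ; x∋ = λ { p≤t pos′ → case ≤-antisym p≤t (At-≤ pos′) of λ { refl → subst (_ ∋_) (At-functional last pos′) x∋c } } }))
    ... | no iso = inj₂ (b , iso , x∋c , y∋c , [ isolated-walk iso ∘ bag-walk _ x∋c , isolated-walk iso ∘ bag-walk _ y∋c ]′)
    charge {x} {y} {inj₂ (e , i)} x∈ y∉ x∋c y∋c with ordered x∈ y∉
    ... | z , x∋z , z-least with walk-outcome (mid i) x∋c (bag-walk x x∋c x∋z)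
    ... | inj₁ cover = inj₁ (inj₁ (e , record
          { a = 0 ; pos = mid i ; y∋z = y∋c ; x∋ = λ (_ , t≤) → cover t≤ ; a-least = λ _ () }))
    ... | inj₂ (inj₁ cover) = inj₁ (inj₂ (e , record { pos = mid i ; y∋z = y∋c ; x∋ = cover }))
    -- A walk whose final vertex is an end of `e` is reported as ending on `e`; it counts as
    -- reaching that end.
    ... | inj₂ (inj₂ (_ , first , cover)) = inj₁ (inj₁ (e , record
          { a = 0 ; pos = mid i ; y∋z = y∋c ; x∋ = cover ∘ inj₂ ; a-least = λ _ () }))
    ... | inj₂ (inj₂ (_ , last , cover)) = inj₁ (inj₂ (e , record
          { pos = mid i ; y∋z = y∋c ; x∋ = λ p≤t pos → cover (inj₁ (p≤t , At-≤ pos)) pos }))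
    ... | inj₂ (inj₂ (_ , mid j , cover)) = inj₁ (inj₁ (e , record
          { pos = mid i ; y∋z = y∋c ; x∋ = cover ∘ inj₂ ; a-least = least }))
      where
      -- The witnesses of x preceding y and x preceding y′ are compared. Nothing above an inner
      -- vertex is a branch vertex, and each witness is below the other, so both are inner vertices
      -- of `e`. A vertex of y′ on `e` then cannot come before the first vertex of x.
      least : ∀ {y′ q w} → y′ ∉ X → q < suc (toℕ j) → Pos e q w → ¬ y′ ∋ w
      least y′∉ q<a pos y′∋w with ordered x∈ y′∉
      ... | z′ , x∋z′ , z′-least with z′ | z-least z′ (inj₁ x∋z′) | z′-least _ (inj₁ x∋z) | z′-least _ (inj₂ y′∋w)
      least y′∉ q<a (mid l) y′∋w | _ | inj₂ (e′ , k) | e≤e′ , j≤k | e′≤e , _ | _ , k≤l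
        with toℕ-injective (≤-antisym e≤e′ e′≤e)
      ... | refl = <⇒≱ q<a (s≤s (≤-trans (j≤k refl) (k≤l refl)))

    Meet : Vertex G → Vertex G → Set
    Meet x y = ∃[ z ] (x ∋ z × y ∋ z)

    -- The shared vertex with the smaller position lies in the other segment: it is not past that
    -- segment's upper end, and `a-least` keeps it from lying before `a`.
    left-conflict : ∀ {e x y x′ y′} → y ∉ X → y′ ∉ X → Left e x y → Left e x′ y′ → Meet x y′ ⊎ Meet x′ y
    left-conflict y∉ y′∉ L L′ with ≤-total (Left.p L) (Left.p L′)
    ... | inj₁ p≤p′ = inj₂ (L.z , L′.x∋ (≮⇒≥ (λ p<a′ → L′.a-least y∉ p<a′ L.pos L.y∋z) , p≤p′) L.pos , L.y∋z)
      where
      module L = Left L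
      module L′ = Left L′
    ... | inj₂ p′≤p = inj₁ (L′.z , L.x∋ (≮⇒≥ (λ p′<a → L.a-least y′∉ p′<a L′.pos L′.y∋z) , p′≤p) L′.pos , L′.y∋z)
      where
      module L = Left L
      module L′ = Left L′

    -- Nearer to the target means a larger position, and each segment extends up to the target.
    right-conflict : ∀ {e x y x′ y′} → Right e x y → Right e x′ y′ → Meet x y′ ⊎ Meet x′ y
    right-conflict R R′ with ≤-total (Right.p R) (Right.p R′)
    ... | inj₁ p≤p′ = inj₁ (R′.z , R.x∋ p≤p′ R′.pos , R′.y∋z)
      where
      module R = Right R
      module R′ = Right R′
    ... | inj₂ p′≤p = inj₂ (R.z , R′.x∋ p′≤p R.pos , R.y∋z)
      where
      module R = Right R
      module R′ = Right R′

    code : ∀ {x y} → Charge x y → Fin (2 * ‖ H ‖)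
    code (inj₁ (e , _)) = combine (zero {1}) e
    code (inj₂ (e , _)) = combine (suc (zero {0})) e

    code-conflict : ∀ {x y x′ y′} → y ∉ X → y′ ∉ X → (c : Charge x y) (c′ : Charge x′ y′) →
                    code c ≡ code c′ → Meet x y′ ⊎ Meet x′ y
    code-conflict y∉ y′∉ (inj₁ (e , L)) (inj₁ (e′ , L′)) eq with combine-injective (zero {1}) e zero e′ eq
    ... | _ , refl = left-conflict y∉ y′∉ L L′
    code-conflict y∉ y′∉ (inj₂ (e , R)) (inj₂ (e′ , R′)) eq with combine-injective (suc (zero {0})) e (suc zero) e′ eq
    ... | _ , refl = right-conflict R R′
    code-conflict y∉ y′∉ (inj₁ (e , L)) (inj₂ (e′ , R)) eq with combine-injective (zero {1}) e (suc zero) e′ eq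
    ... | () , _
    code-conflict y∉ y′∉ (inj₂ (e , R)) (inj₁ (e′ , L)) eq with combine-injective (suc (zero {0})) e zero e′ eq
    ... | () , _

    -- As x′ precedes y and y contains the isolated b, the first vertex of x′ is an isolated d with
    -- d ≤ b. By connectedness d is the whole bag of x′, so c is d and y′ contains d. As x precedes
    -- y′, also b ≤ d. Hence y′ contains b and meets x.
    lonely-conflict : ∀ {b x y x′ y′ c} → x ∈ X → y ∉ X → x′ ∈ X → y′ ∉ X → LonelyAt b x y →
                      x′ ∋ c → y′ ∋ c → Meet x y′
    lonely-conflict {b} {x} {y} {x′} {y′} {c} x∈ y∉ x′∈ y′∉ (iso , x∋b , y∋b , only) x′∋c y′∋c
      with ordered x′∈ y∉ | ordered x∈ y′∉
    ... | z′ , x′∋z′ , z′-least | z , x∋z , z-least with only (inj₁ x∋z)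
    ... | refl with z′ | z′-least _ (inj₂ y∋b)
    ... | inj₁ d | d≼b with d≼b iso
    ... | iso-d , d≤b with isolated-walk iso-d (bag-walk x′ x′∋z′ x′∋c)
    ... | refl with z-least _ (inj₂ y′∋c)
    ... | b≼d with toℕ-injective (≤-antisym (proj₂ (b≼d iso-d)) d≤b)
    ... | refl = inj₁ b , x∋b , y′∋c

    other : ∀ {m} → 1 < m → (i : Fin m) → ∃[ j ] j ≢ i
    other (s≤s (s≤s _)) zero    = suc zero , λ ()
    other (s≤s (s≤s _)) (suc i) = zero , λ ()

    mim-prefix-≤ : mim G X ≤ 1 ⊔ 2 * ‖ H ‖
    mim-prefix-≤ = mim-≤ G X bound
      where
      bound : ∀ {m} → InducedMatching G X m → m ≤ 1 ⊔ 2 * ‖ H ‖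
      bound {m} M with m ≤? 1
      ... | yes m≤1 = ≤-trans m≤1 (m≤m⊔n 1 (2 * ‖ H ‖))
      ... | no m≰1 = ≤-trans (injective⇒≤ {f = λ i → code (charged i)} inj) (m≤n⊔m 1 _)
        where
        open InducedMatching M

        x≢y : ∀ i j → x i ≢ y j
        x≢y i j eq = y∉ j (subst (_∈ X) eq (x∈ i))

        meet⇒≡ : ∀ i j → Meet (x i) (y j) → i ≡ j
        meet⇒≡ i j (z , xz , yz) = InducedMatching.only M i j
          (Equivalence.from (adj⇔meet _ _ (x≢y i j)) (to z , x∈p∩q⁺ (xz , yz)))

        meets : ∀ i → Meet (x i) (y i)
        meets i with Equivalence.to (adj⇔meet _ _ (x≢y i i)) (matched i)
        ... | v , v∈ with Bijection.surjective vertices v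
        ... | z , to≡ with to≡ refl
        ... | refl = z , x∈p∩q⁻ _ _ v∈

        charged : ∀ i → Charge (x i) (y i)
        charged i with meets i
        ... | c , xc , yc with charge (x∈ i) (y∉ i) xc yc
        ... | inj₁ ch = ch
        -- A lonely edge conflicts with every other edge, and the matching has at least two.
        ... | inj₂ (b , lonely) with other (≰⇒> m≰1) i
        ... | j , j≢i with meets j
        ... | d , xd , yd = contradiction
          (sym (meet⇒≡ i j (lonely-conflict (x∈ i) (y∉ i) (x∈ j) (y∉ j) lonely xd yd))) j≢i

        inj : ∀ {i j} → code (charged i) ≡ code (charged j) → i ≡ j
        inj {i} {j} eq = [ meet⇒≡ i j , sym ∘ meet⇒≡ j i ]′
          (code-conflict (y∉ i) (y∉ j) (charged i) (charged j) eq)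

-- The caterpillar

-- Duplicate-free lists with the same members are permutations of each other, so computing a degree
-- amounts to naming the neighbours.
length-filter-allFin : ∀ {n} {P : Fin n → Set} (P? : Decidable P) {ys} → Unique ys →
                       (∀ {i} → P i → i ∈ˡ ys) → (∀ {i} → i ∈ˡ ys → P i) →
                       length (filter P? (allFin n)) ≡ length ys
length-filter-allFin {n} P? uys P⇒∈ ∈⇒P = ↭-length (∼bag⇒↭
  (unique∧set⇒bag (Unique.filter⁺ P? (Unique.allFin⁺ n)) uys
    (mk⇔ (P⇒∈ ∘ proj₂ ∘ ∈-filter⁻ P? {xs = allFin n}) (∈-filter⁺ P? (∈-allFin _) ∘ ∈⇒P))))

module _ {n} {P : Fin n → Set} (P? : Decidable P) where

  ∈-tabulate-does⁺ : ∀ {i} → P i → i ∈ Vec.tabulate (does ∘ P?)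
  ∈-tabulate-does⁺ {i} Pi = lookup⇒[]= i _ (trans (lookup∘tabulate (does ∘ P?) i) (dec-true (P? i) Pi))

  ∈-tabulate-does⁻ : ∀ {i} → i ∈ Vec.tabulate (does ∘ P?) → P i
  ∈-tabulate-does⁻ {i} i∈ with P? i | trans (sym (lookup∘tabulate (does ∘ P?) i)) ([]=⇒lookup i∈)
  ... | yes Pi | _ = Pi

module Caterpillar (k : ℕ) where

  N : ℕ
  N = suc (suc k)

  Node : Set
  Node = Fin N ⊎ Fin k

  num : Node → Fin (N + k)
  num = join N k

  num⁻¹ : Fin (N + k) → Node
  num⁻¹ = splitAt N

  num-injective : ∀ x y → num x ≡ num y → x ≡ y
  num-injective x y eq = trans (sym (splitAt-join N k x)) (trans (cong num⁻¹ eq) (splitAt-join N k y))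

  next : ∀ {n} → Fin (suc n) → Fin (suc n)
  next i with view i
  ... | ‵fromℕ     = fromℕ _
  ... | ‵inject₁ j = suc j

  next-fromℕ : ∀ n → next (fromℕ n) ≡ fromℕ n
  next-fromℕ n rewrite view-fromℕ n = refl

  next-inject₁ : ∀ {n} (i : Fin n) → next (inject₁ i) ≡ suc i
  next-inject₁ i rewrite view-inject₁ i = refl

  up : Node → Node
  up (inj₁ i) = inj₁ (next i)
  up (inj₂ j) = inj₁ (suc (inject₁ j))

  parent : Fin (N + k) → Fin (N + k)
  parent = num ∘ up ∘ num⁻¹

  parent-num : ∀ x → parent (num x) ≡ num (up x)
  parent-num x = cong (num ∘ up) (splitAt-join N k x)

  top : Node
  top = inj₁ (fromℕ (suc k))

  fold-num : ∀ x m → fold (num x) parent m ≡ num (fold x up m)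
  fold-num x zero    = refl
  fold-num x (suc m) = trans (cong parent (fold-num x m)) (parent-num (fold x up m))

  -- A pendant vertex gets the height of its parent. The leaf for position i then has height i, and
  -- the descendants of path vertex i are the nodes of height at most i.
  height : Node → ℕ
  height (inj₁ i) = toℕ i
  height (inj₂ j) = suc (toℕ j)

  height-up : ∀ x → height x ≤ height (up x)
  height-up (inj₁ i) with view i
  ... | ‵fromℕ     = ≤-refl
  ... | ‵inject₁ j = ≤-trans (≤-reflexive (toℕ-inject₁ j)) (n≤1+n _)
  height-up (inj₂ j) = s≤s (≤-reflexive (sym (toℕ-inject₁ j)))

  height-fold : ∀ x m → height x ≤ height (fold x up m)
  height-fold x zero    = ≤-refl
  height-fold x (suc m) = ≤-trans (height-fold x m) (height-up (fold x up m))

  next-suc : ∀ {n} (i j : Fin (suc n)) → toℕ j ≡ suc (toℕ i) → next i ≡ j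
  next-suc i (suc j) eq = trans (cong next i≡) (next-inject₁ j)
    where
    i≡ : i ≡ inject₁ j
    i≡ = toℕ-injective (trans (cong (λ { zero → zero ; (suc m) → m }) (sym eq)) (sym (toℕ-inject₁ j)))

  -- The offset `b` serves path vertices (`b = 0`) and pendant vertices, whose first step enters the
  -- path (`b = 1`).
  climb : ∀ {x b a} → fold x up b ≡ inj₁ a → ∀ m i → m + toℕ a ≡ toℕ i → fold x up (m + b) ≡ inj₁ i
  climb base zero    i eq = trans base (cong inj₁ (toℕ-injective eq))
  climb {a = a} base (suc m) i eq = trans
    (cong up (climb base m i′ (sym (toℕ-fromℕ< <N))))
    (cong inj₁ (next-suc i′ i (trans (sym eq) (cong suc (sym (toℕ-fromℕ< <N))))))
    where
    <N : m + toℕ a < N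
    <N = ≤-trans (≤-reflexive eq) (≤-trans (n≤1+n _) (toℕ<n i))
    i′ = fromℕ< <N

  climb-to : ∀ x i → height x ≤ toℕ i → ∃[ m ] (m < N + k × fold x up m ≡ inj₁ i)
  climb-to (inj₁ a) i ≤i = m + 0 , m< , climb refl m i eq
    where
    m = toℕ i ∸ toℕ a
    eq = m∸n+n≡m ≤i
    m< : m + 0 < N + k
    m< = ≤-trans (s≤s (≤-trans (+-monoʳ-≤ m z≤n) (≤-reflexive eq))) (≤-trans (toℕ<n i) (m≤m+n N k))
  climb-to (inj₂ j) i ≤i = m + 1 , m< , climb refl m i (trans (cong ((m +_) ∘ suc) (toℕ-inject₁ j)) eq)
    where
    m = toℕ i ∸ suc (toℕ j)
    eq = m∸n+n≡m ≤i
    m< : m + 1 < N + k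
    m< = ≤-trans (s≤s (≤-trans (+-monoʳ-≤ m (s≤s z≤n)) (≤-reflexive eq))) (≤-trans (toℕ<n i) (m≤m+n N k))

  ancestor : ∀ x i → height x ≤ toℕ i → ∃[ m ] fold (num x) parent (toℕ {N + k} m) ≡ num (inj₁ i)
  ancestor x i ≤i with climb-to x i ≤i
  ... | m , m< , eq = fromℕ< m< ,
    trans (cong (fold (num x) parent) (toℕ-fromℕ< m<)) (trans (fold-num x m) (cong num eq))

  height-≤ : ∀ x → height x ≤ suc k
  height-≤ (inj₁ i) = toℕ≤pred[n] i
  height-≤ (inj₂ j) = s≤s (≤-trans (n≤1+n _) (toℕ<n j))

  tree : RootedTree
  tree = record
    { size = N + k ; root = num top ; parent = parent
    ; parent-root = trans (parent-num top) (cong (num ∘ inj₁) (next-fromℕ (suc k)))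
    ; root-reached = λ v → subst (λ w → ∃[ m ] fold w parent (toℕ {N + k} m) ≡ num top) (join-splitAt N k v)
        (ancestor (num⁻¹ v) (fromℕ (suc k)) (≤-trans (height-≤ (num⁻¹ v)) (≤-reflexive (sym (toℕ-fromℕ (suc k)))))) }

  open RootedTree tree using (_~_; _~?_; treeDegree; Leaf; Ancestor; ancestor?)

  Linked : Node → Node → Set
  Linked x y = Link k x y ⊎ Link k y x

  up⇒Linked : ∀ x → x ≢ up x → Linked x (up x)
  up⇒Linked (inj₁ i) x≢ with view i
  ... | ‵fromℕ     = contradiction refl x≢
  ... | ‵inject₁ j = inj₁ (along j)
  up⇒Linked (inj₂ j) _ = inj₂ (hang j)

  Link-irrefl : ∀ {x y} → Link k x y → x ≢ y
  Link-irrefl (along zero)    eq with inj₁-injective eq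
  ... | ()
  Link-irrefl (along (suc i)) eq = irrefl i (Fin-suc-injective (inj₁-injective eq))
    where
    irrefl : ∀ {n} (i : Fin n) → inject₁ i ≢ suc i
    irrefl (suc i) eq = irrefl i (Fin-suc-injective eq)
  Link-irrefl (hang i) ()

  Link⇒up : ∀ {x y} → Link k x y → up x ≡ y ⊎ up y ≡ x
  Link⇒up (along i) = inj₁ (cong inj₁ (next-inject₁ i))
  Link⇒up (hang i)  = inj₂ refl

  ~⇒Linked : ∀ x y → num x ~ num y → Linked x y
  ~⇒Linked x y (x≢y , inj₁ px≡y) with num-injective (up x) y (trans (sym (parent-num x)) px≡y)
  ... | refl = up⇒Linked x (x≢y ∘ cong num)
  ~⇒Linked x y (x≢y , inj₂ py≡x) with num-injective (up y) x (trans (sym (parent-num y)) py≡x)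
  ... | refl = swap (up⇒Linked y (x≢y ∘ sym ∘ cong num))

  Linked⇒~ : ∀ x y → Linked x y → num x ~ num y
  Linked⇒~ x y (inj₁ l) = Link-irrefl l ∘ num-injective x y ,
    [ (λ { refl → inj₁ (parent-num x) }) , (λ { refl → inj₂ (parent-num y) }) ]′ (Link⇒up l)
  Linked⇒~ x y (inj₂ l) = Link-irrefl l ∘ num-injective y x ∘ sym ,
    [ (λ { refl → inj₂ (parent-num y) }) , (λ { refl → inj₁ (parent-num x) }) ]′ (Link⇒up l)

  isCaterpillar : IsCaterpillar tree
  isCaterpillar = record
    { k = k
    ; nodes = mk⤖ ((λ {x} {y} → num-injective x y) , λ v → num⁻¹ v , λ { refl → join-splitAt N k v })
    ; links = λ x y → mk⇔ (~⇒Linked x y) (Linked⇒~ x y) }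

  degree≡ : ∀ x {ys} → Unique ys → (∀ {y} → Linked x y → y ∈ˡ ys) → All (Linked x) ys →
            treeDegree (num x) ≡ length ys
  degree≡ x {ys} uys ⇒∈ all = trans
    (length-filter-allFin (num x ~?_) (Unique.map⁺ (λ {x} {y} → num-injective x y) uys) to from)
    (length-map num ys)
    where
    to : ∀ {v} → num x ~ v → v ∈ˡ map num ys
    to {v} x~v = subst (_∈ˡ map num ys) (join-splitAt N k v) (∈-map⁺ num
      (⇒∈ (~⇒Linked x (num⁻¹ v) (subst (num x ~_) (sym (join-splitAt N k v)) x~v))))
    from : ∀ {v} → v ∈ˡ map num ys → num x ~ v
    from v∈ with ∈-map⁻ num v∈
    ... | y , y∈ , refl = Linked⇒~ x y (All.lookup all y∈)

  data Kind : Node → Set where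
    bottomEnd : Kind (inj₁ zero)
    topEnd    : Kind (inj₁ (suc (fromℕ k)))
    spine     : ∀ j → Kind (inj₁ (suc (inject₁ j)))
    pendant   : ∀ j → Kind (inj₂ j)

  kind : ∀ x → Kind x
  kind (inj₁ zero) = bottomEnd
  kind (inj₁ (suc i)) with view i
  ... | ‵fromℕ     = topEnd
  ... | ‵inject₁ j = spine j
  kind (inj₂ j) = pendant j

  -- The indices of `Link` contain `inject₁`, which blocks matching at fixed end points; explicit
  -- equations can be inverted.
  Link-from : ∀ {x y} → Link k x y →
              (∃[ i ] (x ≡ inj₁ (inject₁ i) × y ≡ inj₁ (suc i))) ⊎ (∃[ i ] (x ≡ inj₁ (suc (inject₁ i)) × y ≡ inj₂ i))
  Link-from (along i) = inj₁ (i , refl , refl)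
  Link-from (hang i)  = inj₂ (i , refl , refl)

  degree-bottomEnd : treeDegree (num (inj₁ zero)) ≡ 1
  degree-bottomEnd = degree≡ (inj₁ zero) {inj₁ (suc zero) ∷ []} ([] ∷ []) complete (inj₁ (along zero) ∷ [])
    where
    complete : ∀ {y} → Linked (inj₁ zero) y → y ∈ˡ inj₁ (suc zero) ∷ []
    complete (inj₁ l) with Link-from l
    ... | inj₁ (zero , _ , refl) = here refl
    complete (inj₂ l) with Link-from l
    ... | inj₁ (_ , _ , ())
    ... | inj₂ (_ , _ , ())

  degree-topEnd : treeDegree (num (inj₁ (suc (fromℕ k)))) ≡ 1
  degree-topEnd = degree≡ _ {inj₁ (inject₁ (fromℕ k)) ∷ []} ([] ∷ []) complete (inj₂ (along (fromℕ k)) ∷ [])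
    where
    complete : ∀ {y} → Linked (inj₁ (suc (fromℕ k))) y → y ∈ˡ inj₁ (inject₁ (fromℕ k)) ∷ []
    complete (inj₁ l) with Link-from l
    ... | inj₁ (_ , eq , _) = contradiction (inj₁-injective eq) fromℕ≢inject₁
    ... | inj₂ (_ , eq , _) = contradiction (Fin-suc-injective (inj₁-injective eq)) fromℕ≢inject₁
    complete (inj₂ l) with Link-from l
    ... | inj₁ (_ , refl , refl) = here refl
    ... | inj₂ (_ , _ , ())

  degree-spine : ∀ j → treeDegree (num (inj₁ (suc (inject₁ j)))) ≡ 3
  degree-spine j = degree≡ _ {inj₁ (inject₁ (inject₁ j)) ∷ inj₁ (suc (suc j)) ∷ inj₂ j ∷ []}
    (((λ eq → distinct j (inj₁-injective eq)) ∷ (λ ()) ∷ []) ∷ ((λ ()) ∷ []) ∷ [] ∷ []) complete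
    (inj₂ (along (inject₁ j)) ∷ inj₁ (along (suc j)) ∷ inj₁ (hang j) ∷ [])
    where
    distinct : ∀ {n} (j : Fin n) → inject₁ (inject₁ j) ≢ suc (suc j)
    distinct (suc j) eq = distinct j (Fin-suc-injective eq)
    complete : ∀ {y} → Linked (inj₁ (suc (inject₁ j))) y → y ∈ˡ inj₁ (inject₁ (inject₁ j)) ∷ inj₁ (suc (suc j)) ∷ inj₂ j ∷ []
    complete (inj₁ l) with Link-from l
    ... | inj₁ (suc i , eq , refl) with inject₁-injective (Fin-suc-injective (inj₁-injective eq))
    ... | refl = there (here refl)
    complete (inj₁ l) | inj₂ (_ , eq , refl) with inject₁-injective (Fin-suc-injective (inj₁-injective eq))
    ... | refl = there (there (here refl))
    complete (inj₂ l) with Link-from l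
    ... | inj₁ (_ , refl , refl) = here refl
    ... | inj₂ (_ , _ , ())

  degree-pendant : ∀ j → treeDegree (num (inj₂ j)) ≡ 1
  degree-pendant j = degree≡ _ {inj₁ (suc (inject₁ j)) ∷ []} ([] ∷ []) complete (inj₂ (hang j) ∷ [])
    where
    complete : ∀ {y} → Linked (inj₂ j) y → y ∈ˡ inj₁ (suc (inject₁ j)) ∷ []
    complete (inj₁ l) with Link-from l
    ... | inj₁ (_ , () , _)
    ... | inj₂ (_ , () , _)
    complete (inj₂ l) with Link-from l
    ... | inj₁ (_ , _ , ())
    ... | inj₂ (_ , refl , refl) = here refl

  -- The bottom end, the pendant vertices in order and the top end carry positions 0 to k + 1. An
  -- inner path vertex, which is not a leaf, repeats the label of its pendant vertex, in agreement
  -- with what the program writes.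
  label : Node → Fin N
  label (inj₁ i) = i
  label (inj₂ j) = suc (inject₁ j)

  leaf : Fin N → Node
  leaf zero = inj₁ zero
  leaf (suc i) with view i
  ... | ‵fromℕ     = inj₁ (suc (fromℕ k))
  ... | ‵inject₁ j = inj₂ j

  label-leaf : ∀ i → label (leaf i) ≡ i
  label-leaf zero = refl
  label-leaf (suc i) with view i
  ... | ‵fromℕ     = refl
  ... | ‵inject₁ j = refl

  height-leaf : ∀ i → height (leaf i) ≡ toℕ i
  height-leaf zero = refl
  height-leaf (suc i) with view i
  ... | ‵fromℕ     = refl
  ... | ‵inject₁ j = cong suc (sym (toℕ-inject₁ j))

  leaf-Leaf : ∀ i → Leaf (num (leaf i))
  leaf-Leaf zero = degree-bottomEnd
  leaf-Leaf (suc i) with view i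
  ... | ‵fromℕ     = degree-topEnd
  ... | ‵inject₁ j = degree-pendant j

  leaf-label : ∀ x → Leaf (num x) → leaf (label x) ≡ x
  leaf-label x x-Leaf with kind x
  ... | bottomEnd = refl
  ... | topEnd rewrite view-fromℕ k = refl
  ... | pendant j rewrite view-inject₁ j = refl
  ... | spine j with trans (sym x-Leaf) (degree-spine j)
  ... | ()

  full-binary : ∀ v → ¬ Leaf v → treeDegree v ≡ 3
  full-binary v ¬leaf = subst (λ w → ¬ Leaf w → treeDegree w ≡ 3) (join-splitAt N k v) (go _ (kind (num⁻¹ v))) ¬leaf
    where
    go : ∀ x → Kind x → ¬ Leaf (num x) → treeDegree (num x) ≡ 3
    go _ bottomEnd   ¬leaf = contradiction degree-bottomEnd ¬leaf
    go _ topEnd      ¬leaf = contradiction degree-topEnd ¬leaf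
    go _ (spine j)   _     = degree-spine j
    go _ (pendant j) ¬leaf = contradiction (degree-pendant j) ¬leaf

  module _ (G : Graph) (ord : Fin N ↔ Vertex G) where
    private module ord = Inverse ord

    Leaf-≡ : {p q : ∃ Leaf} → proj₁ p ≡ proj₁ q → p ≡ q
    Leaf-≡ {_ , ℓ} {_ , ℓ′} refl = cong (_ ,_) (≡-irrelevant ℓ ℓ′)

    decomposition : BranchDecomposition G
    decomposition = record
      { tree = tree
      ; full-binary = full-binary
      ; δ = mk↔ₛ′ (λ (v , _) → ord.to (label (num⁻¹ v))) (λ u → num (leaf (ord.from u)) , leaf-Leaf (ord.from u))
          (λ u → trans (cong (ord.to ∘ label) (splitAt-join N k (leaf (ord.from u))))
                   (trans (cong ord.to (label-leaf (ord.from u))) (ord.strictlyInverseˡ u)))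
          (λ (v , ℓ) → Leaf-≡ (trans (cong (num ∘ leaf) (ord.strictlyInverseʳ _))
                   (trans (cong num (leaf-label (num⁻¹ v) (subst Leaf (sym (join-splitAt N k v)) ℓ))) (join-splitAt N k v))))
      }

    open BranchDecomposition decomposition using (below)

    -- `1 ≤ b` pays for the singleton cuts at pendant vertices; all other cuts are prefixes.
    mimT-≤ : ∀ {b} → 1 ≤ b →
             (∀ X → (∀ {u v} → u ∈ X → v ∉ X → toℕ (ord.from u) < toℕ (ord.from v)) → mim G X ≤ b) →
             mimT decomposition ≤ b
    mimT-≤ {b} 1≤b prefix-≤ = max-≤ (λ w → mim G (below w)) (All.universal cut-≤ (allFin (N + k)))
      where
      leaf-of : Vertex G → Fin (N + k)
      leaf-of u = num (leaf (ord.from u))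

      below⁻ : ∀ x {u} → u ∈ below (num x) → ∃[ m ] fold (leaf (ord.from u)) up m ≡ x
      below⁻ x {u} u∈ with ∈-tabulate-does⁻ (ancestor? (num x) ∘ leaf-of) u∈
      ... | m , eq = toℕ m , num-injective _ x (trans (sym (fold-num (leaf (ord.from u)) (toℕ m))) eq)

      spine-cut : ∀ i {u v} → u ∈ below (num (inj₁ i)) → v ∉ below (num (inj₁ i)) → toℕ (ord.from u) < toℕ (ord.from v)
      spine-cut i {u} {v} u∈ v∉ with below⁻ (inj₁ i) u∈
      ... | m , eq = ≤-<-trans
        (subst (_≤ toℕ i) (height-leaf (ord.from u)) (≤-trans (height-fold _ m) (≤-reflexive (cong height eq))))
        (≰⇒> λ ≤i → v∉ (∈-tabulate-does⁺ (ancestor? (num (inj₁ i)) ∘ leaf-of)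
           (ancestor (leaf (ord.from v)) i (≤-trans (≤-reflexive (height-leaf (ord.from v))) ≤i))))

      pendant-cut : ∀ j {u} → u ∈ below (num (inj₂ j)) → u ≡ ord.to (label (inj₂ j))
      pendant-cut j {u} u∈ with below⁻ (inj₂ j) u∈
      ... | zero , eq = trans (sym (ord.strictlyInverseˡ u))
                          (cong ord.to (trans (sym (label-leaf (ord.from u))) (cong label eq)))
      ... | suc m , eq = contradiction eq (up≢inj₂ (fold _ up m))
        where
        up≢inj₂ : ∀ x → up x ≢ inj₂ j
        up≢inj₂ (inj₁ _) ()
        up≢inj₂ (inj₂ _) ()

      cut-≤ : ∀ w → mim G (below w) ≤ b
      cut-≤ w = subst (λ w → mim G (below w) ≤ b) (join-splitAt N k w) (go (num⁻¹ w))
        where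
        go : ∀ x → mim G (below (num x)) ≤ b
        go (inj₁ i) = prefix-≤ _ (spine-cut i)
        go (inj₂ j) = ≤-trans (mim-singleton-≤1 G _ λ u∈ v∈ → trans (pendant-cut j u∈) (sym (pendant-cut j v∈))) 1≤b

    -- The node numbering is made explicit: path vertices have numbers `i`, pendant vertices
    -- `N + j`.
    record Written (s : Store) : Set where
      field
        size-cell      : s treeSize 0 0 ≡ N + k
        root-cell      : s treeRoot 0 0 ≡ suc k
        parent-top     : s treeParent (suc k) 0 ≡ suc k
        parent-spine   : ∀ {i} → i < suc k → s treeParent i 0 ≡ suc i
        parent-pendant : ∀ {j} → j < k → s treeParent (N + j) 0 ≡ suc j
        leaf-spine     : ∀ i → s leafVertex (toℕ i) 0 ≡ toℕ (ord.to i)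
        leaf-pendant   : ∀ j → s leafVertex (N + toℕ j) 0 ≡ toℕ (ord.to (suc (inject₁ j)))

    Written⇒Outputs : ∀ {s} → Written s → Outputs s decomposition
    Written⇒Outputs {s} W = record
      { size-written = size-cell
      ; root-written = trans root-cell (sym (trans (toℕ-↑ˡ (fromℕ (suc k)) k) (toℕ-fromℕ (suc k))))
      ; parent-written = λ v → subst (λ w → s treeParent (toℕ w) 0 ≡ toℕ (num (up (num⁻¹ v)))) (join-splitAt N k v) (parents (num⁻¹ v))
      ; δ-written = λ v _ → subst (λ w → s leafVertex (toℕ w) 0 ≡ toℕ (ord.to (label (num⁻¹ v)))) (join-splitAt N k v) (leaves (num⁻¹ v))
      }
      where
      open Written W
      parents : ∀ x → s treeParent (toℕ (num x)) 0 ≡ toℕ (num (up x))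
      parents (inj₁ i) rewrite toℕ-↑ˡ i k | toℕ-↑ˡ (next i) k with view i
      ... | ‵fromℕ rewrite toℕ-fromℕ k = parent-top
      ... | ‵inject₁ j rewrite toℕ-inject₁ j = parent-spine (toℕ<n j)
      parents (inj₂ j) rewrite toℕ-↑ʳ N j | toℕ-↑ˡ (inject₁ j) k | toℕ-inject₁ j = parent-pendant (toℕ<n j)
      leaves : ∀ x → s leafVertex (toℕ (num x)) 0 ≡ toℕ (ord.to (label x))
      leaves (inj₁ i) rewrite toℕ-↑ˡ i k = leaf-spine i
      leaves (inj₂ j) rewrite toℕ-↑ʳ N j = leaf-pendant j

-- The program

write-same : ∀ s a i j x → write s a i j x a i j ≡ x
write-same s a i j x
  rewrite dec-true ((a ℕ.≟ a) ×-dec (i ℕ.≟ i) ×-dec (j ℕ.≟ j)) (refl , refl , refl) = refl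

write-row : ∀ s a i j x {i′} → i′ ≢ i → write s a i j x a i′ j ≡ s a i′ j
write-row s a i j x {i′} i′≢i
  rewrite dec-false ((a ℕ.≟ a) ×-dec (i′ ℕ.≟ i) ×-dec (j ℕ.≟ j)) (i′≢i ∘ proj₁ ∘ proj₂) = refl

write-name : ∀ s a i j x {a′ i′ j′} → a′ ≢ a → write s a i j x a′ i′ j′ ≡ s a′ i′ j′
write-name s a i j x {a′} {i′} {j′} a′≢a
  rewrite dec-false ((a′ ℕ.≟ a) ×-dec (i′ ℕ.≟ i) ×-dec (j′ ℕ.≟ j)) (a′≢a ∘ proj₁) = refl

array-toℕ : ∀ {n} (f : Fin n → ℕ) i → array f (toℕ i) ≡ f i
array-toℕ f zero    = refl
array-toℕ f (suc i) = array-toℕ (f ∘ suc) i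

-- Total-correctness triples with a time bound

record Reaches (p : Program) (s : Store) (T : ℕ) (Q : Store → Set) : Set where
  constructor reach
  field
    {t}  : ℕ
    {s′} : Store
    run  : Run p s t s′
    t≤T  : t ≤ T
    post : Q s′

reaches-seq : ∀ {p q s T U Q R} → Reaches p s T Q → (∀ {s′} → Q s′ → Reaches q s′ U R) →
              Reaches (p ⨟ q) s (T + U) R
reaches-seq (reach r t≤ Qs) f with f Qs
... | reach r′ t′≤ Rs = reach (seq r r′) (+-mono-≤ t≤ t′≤) Rs

reaches-weaken : ∀ {p s T U Q R} → T ≤ U → (∀ {s′} → Q s′ → R s′) → Reaches p s T Q → Reaches p s U R
reaches-weaken T≤U Q⇒R (reach r t≤ Qs) = reach r (≤-trans t≤ T≤U) (Q⇒R Qs)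

-- Induction on the number of rounds left. Each round adds one test to its body, and the failing
-- test is the outer `suc`.
reaches-for : ∀ {g body T} n (Inv : ℕ → Store → Set) →
              (∀ {i s} → Inv i s → ⟦ g ⟧ s ≡ n ∸ i) →
              (∀ {i s} → i < n → Inv i s → Reaches body s T (Inv (suc i))) →
              ∀ {s} → Inv 0 s → Reaches (while g loop body) s (suc (n * suc T)) (Inv n)
reaches-for {g} {body} {T} n Inv guard step = go n (+-identityʳ n)
  where
  go : ∀ r {i s} → r + i ≡ n → Inv i s → Reaches (while g loop body) s (suc (r * suc T)) (Inv n)
  go zero    refl inv = reach (stop (trans (guard inv) (n∸n≡0 n))) ≤-refl inv
  go (suc r) {i} eq inv with step (≤-trans (s≤s (m≤n+m i r)) (≤-reflexive eq)) inv
  ... | reach run t≤ inv′ with go r (trans (+-suc r i) eq) inv′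
  ... | reach run′ t′≤ invₙ = reach
    (again (λ g≡0 → m>n⇒m∸n≢0 (≤-trans (s≤s (m≤n+m i r)) (≤-reflexive eq)) (trans (sym (guard inv)) g≡0)) run run′)
    (s≤s (≤-trans (+-mono-≤ t≤ t′≤) (≤-reflexive (+-suc T (r * suc T))))) invₙ

pattern count  = 14
pattern vertex = 15
pattern index′ = 16
pattern placed = 17

cell : Name → Expr
cell a = a ⟨ lit 0 , lit 0 ⟩

-- When `count` is 0 the cells at n + 0 ∸ 1 do not belong to a pendant vertex but
-- to the top end of the spine; they are overwritten when the last vertex is placed
-- and by `finish`.
place : Program
place =
  leafVertex ⟨ cell orderG ⊕ cell count ⊖ lit 1 , lit 0 ⟩≔ cell vertex ⨟
  leafVertex ⟨ cell count , lit 0 ⟩≔ cell vertex ⨟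
  treeParent ⟨ cell orderG ⊕ cell count ⊖ lit 1 , lit 0 ⟩≔ cell count ⨟
  treeParent ⟨ cell count , lit 0 ⟩≔ cell count ⊕ lit 1 ⨟
  placed ⟨ cell vertex , lit 0 ⟩≔ lit 1 ⨟
  count ⟨ lit 0 , lit 0 ⟩≔ cell count ⊕ lit 1

-- The guard subtracts the mark from the membership bit, so it is nonzero exactly for unplaced
-- vertices whose bag contains the vertex numbered by `x`.
visit : Expr → Program
visit x =
  vertex ⟨ lit 0 , lit 0 ⟩≔ lit 0 ⨟
  (while cell orderG ⊖ cell vertex loop
    ((ifnz bags ⟨ cell vertex , x ⟩ ⊖ placed ⟨ cell vertex , lit 0 ⟩ then place else skip) ⨟
     vertex ⟨ lit 0 , lit 0 ⟩≔ cell vertex ⊕ lit 1))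

-- Loops over the vertices and edges of the fixed `H` are unrolled into the program text; their
-- numbers enter only the constant factor.
visitBranches : ∀ {m} → List (Fin m) → Program
visitBranches []       = skip
visitBranches (b ∷ bs) = visit (branchH′ ⟨ lit (toℕ b) , lit 0 ⟩) ⨟ visitBranches bs

visitEdges : ∀ {m} → List (Fin m) → Program
visitEdges []       = skip
visitEdges (e ∷ es) =
  (index′ ⟨ lit 0 , lit 0 ⟩≔ lit 0 ⨟
   (while lenH′ ⟨ lit (toℕ e) , lit 0 ⟩ ⊖ cell index′ loop
     (visit (innerH′ ⟨ lit (toℕ e) , cell index′ ⟩) ⨟
      index′ ⟨ lit 0 , lit 0 ⟩≔ cell index′ ⊕ lit 1))) ⨟
  visitEdges es

finish : Program
finish =
  treeSize ⟨ lit 0 , lit 0 ⟩≔ cell orderG ⊕ (cell orderG ⊖ lit 2) ⨟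
  treeRoot ⟨ lit 0 , lit 0 ⟩≔ cell orderG ⊖ lit 1 ⨟
  treeParent ⟨ cell orderG ⊖ lit 1 , lit 0 ⟩≔ cell orderG ⊖ lit 1

isolatedFirst : (H : Graph) → List (Vertex H)
isolatedFirst H = filter (¬? ∘ touched?) (allFin ∣ H ∣) ++ filter touched? (allFin ∣ H ∣)
  -- Isolation depends on `H` alone, and the program is fixed before any subdivision is given; the
  -- zero lengths are a dummy.
  where open Order H (λ _ → 0)

program : Graph → Program
program H = visitBranches (isolatedFirst H) ⨟ visitEdges (allFin ‖ H ‖) ⨟ finish

-- The vertices are listed in reverse order of placement, so the head of v ∷ L
-- has position length L.
data PlacedAt {A : Set} : List A → ℕ → A → Set where
  here  : ∀ {v L p} → p ≡ length L → PlacedAt (v ∷ L) p v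
  there : ∀ {u v L p} → PlacedAt L p v → PlacedAt (u ∷ L) p v

module _ {A : Set} where

  PlacedAt-< : ∀ {L : List A} {p v} → PlacedAt L p v → p < length L
  PlacedAt-< (here refl) = ≤-refl
  PlacedAt-< (there at)  = m≤n⇒m≤1+n (PlacedAt-< at)

  PlacedAt⇒∈ : ∀ {L : List A} {p v} → PlacedAt L p v → v ∈ˡ L
  PlacedAt⇒∈ (here _)   = here refl
  PlacedAt⇒∈ (there at) = there (PlacedAt⇒∈ at)

  ∈⇒PlacedAt : ∀ {L : List A} {v} → v ∈ˡ L → ∃[ p ] PlacedAt L p v
  ∈⇒PlacedAt (here refl) = _ , here refl
  ∈⇒PlacedAt (there v∈)  = let p , at = ∈⇒PlacedAt v∈ in p , there at

  <⇒PlacedAt : ∀ (L : List A) {p} → p < length L → ∃[ v ] PlacedAt L p v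
  <⇒PlacedAt (v ∷ L) (s≤s p≤) with m≤n⇒m<n∨m≡n p≤
  ... | inj₁ p<  = let u , at = <⇒PlacedAt L p< in u , there at
  ... | inj₂ p≡  = v , here p≡

  PlacedAt-functional : ∀ {L : List A} {p u v} → PlacedAt L p u → PlacedAt L p v → u ≡ v
  PlacedAt-functional (here _)    (here _)     = refl
  PlacedAt-functional (here refl) (there at)   = contradiction (PlacedAt-< at) (<-irrefl refl)
  PlacedAt-functional (there at)  (here refl)  = contradiction (PlacedAt-< at) (<-irrefl refl)
  PlacedAt-functional (there at)  (there at′)  = PlacedAt-functional at at′

m≤n+m∸1 : ∀ {n} m → 0 < n → m ≤ n + m ∸ 1
m≤n+m∸1 {suc n} m _ = m≤n+m m n

n+j≢n+m∸1 : ∀ n {m j} → suc j < m → n + j ≢ n + m ∸ 1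
n+j≢n+m∸1 n {suc m} (s≤s j<m) eq rewrite +-suc n m = <-irrefl (+-cancelˡ-≡ n _ _ eq) j<m

-- Units of M², where M bounds the order of `G` and all lengths. A visit takes at most 2 + 9n ≤ 11M
-- steps, an edge at most 2 + M(13M) ≤ 15M², and the final `skip` gives the 1.
branchesCost edgesCost : ∀ {m} → List (Fin m) → ℕ
branchesCost bs = length bs * 11 + 1
edgesCost    es = length es * 15 + 1

-- Invariants and correctness of the program

module Correctness {H : Graph} (I : Instance H) where
  open Instance I
  open Cuts I
  open DecMembership (_≟_ {∣ G ∣}) using () renaming (_∈?_ to _∈ˡ?_)

  -- When a vertex is placed, `separated` turns into the new instances of `sorted`, so transitivity
  -- of `Prec` never has to be argued.
  record Sorted (L : List (Vertex G)) : Set where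
    field
      positions-unique : ∀ {p q v} → PlacedAt L p v → PlacedAt L q v → p ≡ q
      sorted           : ∀ {p q u v} → PlacedAt L p u → PlacedAt L q v → p < q → Prec u v
      separated        : ∀ {u v} → u ∈ˡ L → v ∉ˡ L → Prec u v

  Sorted-[] : Sorted []
  Sorted-[] = record { positions-unique = λ () ; sorted = λ () ; separated = λ () }

  Sorted-∷ : ∀ {v L} → v ∉ˡ L → (∀ {u} → u ∉ˡ L → Prec v u) → Sorted L → Sorted (v ∷ L)
  Sorted-∷ {v} {L} v∉L v-first S = record
    { positions-unique = unique
    ; sorted = λ
        { (here refl) (here refl) p<q → contradiction p<q (<-irrefl refl)
        ; (here refl) (there at)  p<q → contradiction (PlacedAt-< at) (<⇒≯ p<q)
        ; (there at)  (here _)    p<q → separated (PlacedAt⇒∈ at) v∉L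
        ; (there at)  (there at′) p<q → sorted at at′ p<q }
    ; separated = λ
        { (here refl) u∉ → v-first (u∉ ∘ there)
        ; (there u∈)  u∉ → separated u∈ (u∉ ∘ there) }
    }
    where
    open Sorted S
    unique : ∀ {p q u} → PlacedAt (v ∷ L) p u → PlacedAt (v ∷ L) q u → p ≡ q
    unique (here refl) (here refl) = refl
    unique (here _)    (there at)  = contradiction (PlacedAt⇒∈ at) v∉L
    unique (there at)  (here _)    = contradiction (PlacedAt⇒∈ at) v∉L
    unique (there at)  (there at′) = positions-unique at at′

  length-≤ : ∀ {L} → Sorted L → length L ≤ ∣ G ∣
  length-≤ {L} S = injective⇒≤ {f = λ i → proj₁ (at i)} λ {i} {j} eq →
    toℕ-injective (Sorted.positions-unique S (proj₂ (at i)) (subst (PlacedAt L (toℕ j)) (sym eq) (proj₂ (at j))))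
    where
    at : ∀ i → ∃[ v ] PlacedAt L (toℕ {length L} i) v
    at i = <⇒PlacedAt L (toℕ<n i)

  record Holds (L : List (Vertex G)) (s : Store) : Set where
    field
      inputs         : ∀ {a} → a < 10 → ∀ i j → s a i j ≡ input I a i j
      counted        : s count 0 0 ≡ length L
      marked         : ∀ {v} → v ∈ˡ L → s placed (toℕ v) 0 ≡ 1
      unmarked       : ∀ {v} → v ∉ˡ L → s placed (toℕ v) 0 ≡ 0
      leaf-spine     : ∀ {p v} → PlacedAt L p v → s leafVertex p 0 ≡ toℕ v
      leaf-pendant   : ∀ {j v} → PlacedAt L (suc j) v → s leafVertex (∣ G ∣ + j) 0 ≡ toℕ v
      parent-spine   : ∀ {p} → p < length L → s treeParent p 0 ≡ suc p
      parent-pendant : ∀ {j} → suc j < length L → s treeParent (∣ G ∣ + j) 0 ≡ suc j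

    order-cell : s orderG 0 0 ≡ ∣ G ∣
    order-cell = inputs (s≤s z≤n) 0 0

  Holds-[] : Holds [] (input I)
  Holds-[] = record
    { inputs = λ _ _ _ → refl ; counted = refl ; marked = λ () ; unmarked = λ _ → refl
    ; leaf-spine = λ () ; leaf-pendant = λ () ; parent-spine = λ () ; parent-pendant = λ () }

  Holds-vertex : ∀ {L s x} → Holds L s → Holds L (write s vertex 0 0 x)
  Holds-vertex {s = s} h = record
    -- Between literal names `write` reduces by itself; only the variable name `a` calls for an
    -- argument.
    { inputs = λ a<10 i j → trans (write-name s vertex 0 0 _ (<⇒≢ (≤-trans a<10 (m≤m+n 10 5)))) (inputs a<10 i j)
    ; counted = counted ; marked = marked ; unmarked = unmarked
    ; leaf-spine = leaf-spine ; leaf-pendant = leaf-pendant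
    ; parent-spine = parent-spine ; parent-pendant = parent-pendant }
    where open Holds h

  Holds-index : ∀ {L s x} → Holds L s → Holds L (write s index′ 0 0 x)
  Holds-index {s = s} h = record
    { inputs = λ a<10 i j → trans (write-name s index′ 0 0 _ (<⇒≢ (≤-trans a<10 (m≤m+n 10 6)))) (inputs a<10 i j)
    ; counted = counted ; marked = marked ; unmarked = unmarked
    ; leaf-spine = leaf-spine ; leaf-pendant = leaf-pendant
    ; parent-spine = parent-spine ; parent-pendant = parent-pendant }
    where open Holds h

  afterPlace : Store → ℕ → ℕ → ℕ → Store
  afterPlace s n m v =
    write (write (write (write (write (write s
      leafVertex (n + m ∸ 1) 0 v) leafVertex m 0 v)
      treeParent (n + m ∸ 1) 0 m) treeParent m 0 (m + 1))
      placed v 0 1) count 0 0 (m + 1)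

  -- A run produces the written numbers as cell contents; the three equations replace them by their
  -- meaning.
  Holds-place : ∀ {L s n m v v′} → Holds L s → v ∉ˡ L → length L < ∣ G ∣ →
                n ≡ ∣ G ∣ → m ≡ length L → v′ ≡ toℕ v → Holds (v ∷ L) (afterPlace s n m v′)
  Holds-place {L} {s} {_} {_} {v} h v∉L m<n refl refl refl = record
    { inputs = λ a<10 i j →
        trans (write-name s₅ count 0 0 _ (<⇒≢ (≤-trans a<10 (m≤m+n 10 4))))
        (trans (write-name s₄ placed (toℕ v) 0 _ (<⇒≢ (≤-trans a<10 (m≤m+n 10 7))))
        (trans (write-name s₃ treeParent m 0 _ (<⇒≢ (≤-trans a<10 (m≤m+n 10 2))))
        (trans (write-name s₂ treeParent (n + m ∸ 1) 0 _ (<⇒≢ (≤-trans a<10 (m≤m+n 10 2))))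
        (trans (write-name s₁ leafVertex m 0 _ (<⇒≢ (≤-trans a<10 (m≤m+n 10 3))))
        (trans (write-name s leafVertex (n + m ∸ 1) 0 _ (<⇒≢ (≤-trans a<10 (m≤m+n 10 3))))
        (inputs a<10 i j))))))
    ; counted = +-comm m 1
    ; marked = λ
        { (here refl) → write-same s₄ placed (toℕ v) 0 1
        ; {u} (there u∈) → trans (write-row s₄ placed (toℕ v) 0 1 (λ eq → v∉L (subst (_∈ˡ L) (toℕ-injective eq) u∈)))
                                 (marked u∈) }
    ; unmarked = λ u∉ → trans (write-row s₄ placed (toℕ v) 0 1 (u∉ ∘ here ∘ toℕ-injective)) (unmarked (u∉ ∘ there))
    ; leaf-spine = λ
        { (here refl) → write-same s₁ leafVertex m 0 (toℕ v)
        ; (there at) → trans (leaf-old (PlacedAt-< at)) (leaf-spine at) }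
    ; leaf-pendant = λ
        { {j} (here eq) → trans (write-row s₁ leafVertex m 0 _ (n+j≢m j))
            (trans (cong (λ i → s₁ leafVertex i 0) (sym (last≡ eq))) (write-same s leafVertex (n + m ∸ 1) 0 (toℕ v)))
        ; {j} (there at) → trans (write-row s₁ leafVertex m 0 _ (n+j≢m j))
            (trans (write-row s leafVertex (n + m ∸ 1) 0 _ (n+j≢n+m∸1 n (PlacedAt-< at))) (leaf-pendant at)) }
    ; parent-spine = λ p< → [ parent-old , (λ { refl → trans (write-same s₃ treeParent m 0 (m + 1)) (+-comm m 1) }) ]′
        (m≤n⇒m<n∨m≡n (≤-pred p<))
    ; parent-pendant = λ {j} j< → trans (write-row s₃ treeParent m 0 _ (n+j≢m j)) (parent-new j (m≤n⇒m<n∨m≡n (≤-pred j<)))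
    }
    where
    open Holds h
    n = ∣ G ∣
    m = length L
    s₁ = write s leafVertex (n + m ∸ 1) 0 (toℕ v)
    s₂ = write s₁ leafVertex m 0 (toℕ v)
    s₃ = write s₂ treeParent (n + m ∸ 1) 0 m
    s₄ = write s₃ treeParent m 0 (m + 1)
    s₅ = write s₄ placed (toℕ v) 0 1

    p≢n+m∸1 : ∀ {p} → p < m → p ≢ n + m ∸ 1
    p≢n+m∸1 p<m = <⇒≢ (≤-trans p<m (m≤n+m∸1 m (≤-trans (s≤s z≤n) m<n)))

    n+j≢m : ∀ j → n + j ≢ m
    n+j≢m j = >⇒≢ (≤-trans m<n (m≤m+n n j))

    leaf-old : ∀ {p} → p < m → s₂ leafVertex p 0 ≡ s leafVertex p 0
    leaf-old p<m = trans (write-row s₁ leafVertex m 0 _ (<⇒≢ p<m)) (write-row s leafVertex (n + m ∸ 1) 0 _ (p≢n+m∸1 p<m))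

    parent-old : ∀ {p} → p < m → s₄ treeParent p 0 ≡ suc p
    parent-old p<m = trans (write-row s₃ treeParent m 0 _ (<⇒≢ p<m))
      (trans (write-row s₂ treeParent (n + m ∸ 1) 0 _ (p≢n+m∸1 p<m)) (parent-spine p<m))

    last≡ : ∀ {j} → suc j ≡ m → n + m ∸ 1 ≡ n + j
    last≡ {j} eq = trans (cong (λ m → n + m ∸ 1) (sym eq)) (cong (_∸ 1) (+-suc n j))

    parent-new : ∀ j → suc j < m ⊎ suc j ≡ m → s₃ treeParent (n + j) 0 ≡ suc j
    parent-new j (inj₁ j<) = trans (write-row s₂ treeParent (n + m ∸ 1) 0 _ (n+j≢n+m∸1 n j<)) (parent-pendant j<)
    parent-new j (inj₂ eq) = trans (cong (λ i → s₃ treeParent i 0) (sym (last≡ eq)))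
      (trans (write-same s₂ treeParent (n + m ∸ 1) 0 m) (sym eq))

  -- `R` bounds what the bags of unplaced vertices may still contain. Every visit removes one vertex
  -- of the subdivision from it, until nothing is left and, bags being non-empty, all vertices are
  -- placed.
  record State (i : ℕ) (R : V′ → Set) (s : Store) : Set where
    field
      {L}       : List (Vertex G)
      ordered   : Sorted L
      holds     : Holds L s
      at-index  : s index′ 0 0 ≡ i
      remaining : ∀ {v w} → v ∉ˡ L → v ∋ w → R w

  State-weaken : ∀ {i R R′ s} → (∀ {w} → R w → R′ w) → State i R s → State i R′ s
  State-weaken R⇒R′ st = record
    { ordered = ordered ; holds = holds ; at-index = at-index ; remaining = λ v∉L v∋w → R⇒R′ (remaining v∉L v∋w) }
    where open State st

  bag-entry : ∀ {L s} → Holds L s → ∀ v z → s bags (toℕ v) (toℕ (to z)) ≡ (if does (to z ∈? bag v) then 1 else 0)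
  bag-entry h v z = trans (Holds.inputs h ≤-refl (toℕ v) (toℕ (to z)))
    (trans (array-toℕ _ v) (array-toℕ _ (to z)))

  module Visit (x : Expr) (i : ℕ) (R : V′ → Set) (z : V′)
               (x-value : ∀ {L s} → Holds L s → s index′ 0 0 ≡ i → ⟦ x ⟧ s ≡ toℕ (to z))
               (z-least : ∀ {w} → R w → z ≼ w) where

    -- During a scan `z` stays in `R`, since later vertices may contain it; a completed scan shows
    -- that no unplaced one does.
    record Scan (j : ℕ) (s : Store) : Set where
      field
        state     : State i R s
        at-vertex : s vertex 0 0 ≡ j
      open State state public
      field
        scanned   : ∀ {v} → v ∉ˡ L → toℕ v < j → ¬ v ∋ z

    guard : Expr
    guard = bags ⟨ cell vertex , x ⟩ ⊖ placed ⟨ cell vertex , lit 0 ⟩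

    guard-value : ∀ {s} v (sc : Scan (toℕ v) s) →
                  ⟦ guard ⟧ s ≡ (if does (to z ∈? bag v) then 1 else 0) ∸ s placed (toℕ v) 0
    guard-value {s} v sc = trans
      (cong₂ (λ a b → s bags a b ∸ s placed a 0) at-vertex (x-value holds at-index))
      (cong (_∸ s placed (toℕ v) 0) (bag-entry holds v z))
      where open Scan sc

    skipped : ∀ {s} v (sc : Scan (toℕ v) s) → let open Scan sc in
              (v ∉ˡ L → ¬ v ∋ z) → Scan (suc (toℕ v)) (write s vertex 0 0 (s vertex 0 0 + 1))
    skipped v sc v-done = record
      { state = record { ordered = ordered ; holds = Holds-vertex holds ; at-index = at-index ; remaining = remaining }
      ; at-vertex = trans (cong (_+ 1) at-vertex) (+-comm (toℕ v) 1)
      ; scanned = λ u∉L u< → [ scanned u∉L , (λ eq → case toℕ-injective eq of λ { refl → v-done u∉L }) ]′ (m≤n⇒m<n∨m≡n (≤-pred u<))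
      }
      where open Scan sc

    body-reaches : ∀ {s} v → Scan (toℕ v) s →
      Reaches ((ifnz guard then place else skip) ⨟ vertex ⟨ lit 0 , lit 0 ⟩≔ cell vertex ⊕ lit 1) s 8 (Scan (suc (toℕ v)))
    body-reaches {s} v sc with v ∈ˡ? Scan.L sc | to z ∈? bag v | guard-value v sc
    ... | yes v∈L | yes _ | g = reach (seq (else′ (trans g (cong (1 ∸_) (Holds.marked (Scan.holds sc) v∈L))) skip) assign)
            (m≤m+n 3 5) (skipped v sc (contradiction v∈L))
    ... | _ | no v∌z | g = reach (seq (else′ (trans g (0∸n≡0 (s placed (toℕ v) 0))) skip) assign)
            (m≤m+n 3 5) (skipped v sc (λ _ → v∌z))
    -- Eight steps: the test, the six assignments of `place`, and the increment of `vertex`.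
    ... | no v∉L | yes v∋z | g = reach
      (seq (then′ (λ g≡0 → case trans (sym g≡0) (trans g (cong (1 ∸_) (Holds.unmarked holds v∉L))) of λ ())
             (seq assign (seq assign (seq assign (seq assign (seq assign assign)))))) assign)
      ≤-refl record
        { state = record
          { ordered = ordered′
          ; holds = Holds-vertex (Holds-place holds v∉L (length-≤ ordered′) (Holds.order-cell holds) (Holds.counted holds) at-vertex)
          ; at-index = at-index
          ; remaining = λ u∉ → remaining (u∉ ∘ there) }
        ; at-vertex = trans (cong (_+ 1) at-vertex) (+-comm (toℕ v) 1)
        ; scanned = λ u∉ u< → [ scanned (u∉ ∘ there) , (λ eq → contradiction (here (toℕ-injective eq)) u∉) ]′ (m≤n⇒m<n∨m≡n (≤-pred u<))
        }
      where
      open Scan sc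
      -- Neither `v` nor `u` has been placed, so both bags lie in `R`, where `z` is least: it
      -- witnesses that `v` precedes `u`.
      ordered′ : Sorted (v ∷ L)
      ordered′ = Sorted-∷ v∉L (λ u∉L → z , v∋z , λ w → [ z-least ∘ remaining v∉L , z-least ∘ remaining u∉L ]′) ordered

    visit-reaches : ∀ {s} → State i R s → Reaches (visit x) s (2 + ∣ G ∣ * 9) (State i (λ w → R w × w ≢ z))
    visit-reaches st = reaches-seq
      (reach {Q = Scan 0} assign ≤-refl record
        { state = record { ordered = ordered ; holds = Holds-vertex holds ; at-index = at-index ; remaining = remaining }
        ; at-vertex = refl ; scanned = λ _ () })
      (λ sc → reaches-weaken ≤-refl done (reaches-for ∣ G ∣ Scan
        (λ sc → cong₂ _∸_ (Holds.order-cell (Scan.holds sc)) (Scan.at-vertex sc))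
        (λ {j} {s} j< sc → subst (λ j → Reaches _ s 8 (Scan (suc j))) (toℕ-fromℕ< j<)
          (body-reaches (fromℕ< j<) (subst (λ j → Scan j s) (sym (toℕ-fromℕ< j<)) sc)))
        sc))
      where
      open State st
      done : ∀ {s} → Scan ∣ G ∣ s → State i (λ w → R w × w ≢ z) s
      done sc = record
        { ordered = S.ordered ; holds = S.holds ; at-index = S.at-index
        ; remaining = λ {v} v∉L v∋w → S.remaining v∉L v∋w , λ { refl → S.scanned v∉L (toℕ<n v) v∋w } }
        where
        module S = Scan sc

  open Visit using (visit-reaches)

  BranchesLeft : List (Vertex H) → V′ → Set
  BranchesLeft bs (inj₁ b) = b ∈ˡ bs
  BranchesLeft bs (inj₂ _) = ⊤

  EdgesLeft : List (Fin ‖ H ‖) → V′ → Set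
  EdgesLeft es (inj₁ _)       = ⊥
  EdgesLeft es (inj₂ (e , _)) = e ∈ˡ es

  InnerLeft : Fin ‖ H ‖ → ℕ → List (Fin ‖ H ‖) → V′ → Set
  InnerLeft e i es (inj₁ _)        = ⊥
  InnerLeft e i es (inj₂ (e′ , j)) = e′ ∈ˡ e ∷ es × (e ≡ e′ → i ≤ toℕ j)

  order≤size : ∣ G ∣ ≤ inputSize I
  order≤size = ≤-trans (m≤m+n ∣ G ∣ ‖ G ‖) (≤-trans (m≤m+n _ ∣ graph ∣) (m≤m+n _ ‖ graph ‖))

  len≤size : ∀ e → len e ≤ inputSize I
  len≤size e = ≤-trans (injective⇒≤ {f = inner e} λ eq → inner-injective (Bijection.injective vertices eq))
    (≤-trans (m≤n+m ∣ graph ∣ (∣ G ∣ + ‖ G ‖)) (m≤m+n _ ‖ graph ‖))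
    where
    inner-injective : ∀ {i j} → _≡_ {A = V′} (inj₂ (e , i)) (inj₂ (e , j)) → i ≡ j
    inner-injective refl = refl

  -- A comparison with a touched vertex on the right is vacuous; only pairs of isolated vertices
  -- need the numerical order.
  isolatedFirst-sorted : AllPairs (λ b b′ → inj₁ b ≼ inj₁ b′) (isolatedFirst H)
  isolatedFirst-sorted = AllPairs.++⁺
    (strengthen (All.all-filter (¬? ∘ touched?) (allFin ∣ H ∣)) (AllPairs.filter⁺ (¬? ∘ touched?) increasing))
    (vacuous (All.map (λ touched iso → iso touched) (All.all-filter touched? (allFin ∣ H ∣))))
    (All.map (λ _ → All.map (λ touched iso → contradiction touched iso) (All.all-filter touched? (allFin ∣ H ∣)))
      (All.all-filter (¬? ∘ touched?) (allFin ∣ H ∣)))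
    where
    increasing : AllPairs (λ b b′ → toℕ b ≤ toℕ b′) (allFin ∣ H ∣)
    increasing = AllPairs.tabulate⁺-< <⇒≤
    strengthen : ∀ {bs} → All Isolated bs → AllPairs (λ b b′ → toℕ b ≤ toℕ b′) bs →
                 AllPairs (λ b b′ → inj₁ b ≼ inj₁ b′) bs
    strengthen []           []         = []
    strengthen (iso ∷ isos) (b≤ ∷ bs≤) = All.map (λ ≤b′ _ → iso , ≤b′) b≤ ∷ strengthen isos bs≤
    vacuous : ∀ {bs} → All (λ b → ¬ Isolated b) bs → AllPairs (λ b b′ → inj₁ b ≼ inj₁ b′) bs
    vacuous []                 = []
    vacuous (_ ∷ touched) = All.map (λ t iso → contradiction iso t) touched ∷ vacuous touched

  isolatedFirst-complete : ∀ b → b ∈ˡ isolatedFirst H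
  isolatedFirst-complete b with touched? b
  ... | yes touched = ∈-++⁺ʳ (filter (¬? ∘ touched?) (allFin ∣ H ∣)) (∈-filter⁺ touched? (∈-allFin b) touched)
  ... | no iso      = ∈-++⁺ˡ (∈-filter⁺ (¬? ∘ touched?) (∈-allFin b) iso)

  initial : State 0 (BranchesLeft (isolatedFirst H)) (input I)
  initial = record { ordered = Sorted-[] ; holds = Holds-[] ; at-index = refl ; remaining = λ {_} {w} _ _ → all w }
    where
    all : ∀ w → BranchesLeft (isolatedFirst H) w
    all (inj₁ b) = isolatedFirst-complete b
    all (inj₂ _) = tt

  Result : Store → Set
  Result s = ∃[ D ] (Outputs {G} s D × IsCaterpillar (BranchDecomposition.tree D) × mimT D ≤ 1 ⊔ 2 * ‖ H ‖)

  module Final (k : ℕ) (order≡ : ∣ G ∣ ≡ suc (suc k)) {L : List (Vertex G)}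
               (ordered : Sorted L) (complete : ∀ v → v ∈ˡ L) where
    open Sorted ordered
    open Caterpillar k

    length≡ : length L ≡ N
    length≡ = trans (≤-antisym (length-≤ ordered) (injective⇒≤ {f = λ v → fromℕ< (pos< v)} λ {u} {v} eq →
      PlacedAt-functional (proj₂ (position u))
        (subst (λ p → PlacedAt L p v) (sym (trans (sym (toℕ-fromℕ< (pos< u))) (trans (cong toℕ eq) (toℕ-fromℕ< (pos< v)))))
          (proj₂ (position v))))) order≡
      where
      position : ∀ v → ∃[ p ] PlacedAt L p v
      position v = ∈⇒PlacedAt (complete v)
      pos< : ∀ v → proj₁ (position v) < length L
      pos< v = PlacedAt-< (proj₂ (position v))

    at : (i : Fin N) → ∃[ v ] PlacedAt L (toℕ i) v
    at i = <⇒PlacedAt L (≤-trans (toℕ<n i) (≤-reflexive (sym length≡)))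

    position : (v : Vertex G) → ∃[ i ] PlacedAt L (toℕ {N} i) v
    position v with ∈⇒PlacedAt (complete v)
    ... | p , p-at = let p<N = ≤-trans (PlacedAt-< p-at) (≤-reflexive length≡) in
      fromℕ< p<N , subst (λ p → PlacedAt L p v) (sym (toℕ-fromℕ< p<N)) p-at

    ord : Fin N ↔ Vertex G
    ord = mk↔ₛ′ (proj₁ ∘ at) (proj₁ ∘ position)
      (λ v → PlacedAt-functional (proj₂ (at (proj₁ (position v)))) (proj₂ (position v)))
      (λ i → toℕ-injective (positions-unique (proj₂ (position (proj₁ (at i)))) (proj₂ (at i))))

    mim-bound : mimT (decomposition G ord) ≤ 1 ⊔ 2 * ‖ H ‖
    mim-bound = mimT-≤ G ord (m≤m⊔n 1 (2 * ‖ H ‖)) λ X prefix →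
      mim-prefix-≤ X λ {u} {v} u∈ v∉ → sorted (proj₂ (position u)) (proj₂ (position v)) (prefix u∈ v∉)

    afterFinish : Store → ℕ → Store
    afterFinish s n = write (write (write s treeSize 0 0 (n + (n ∸ 2))) treeRoot 0 0 (n ∸ 1)) treeParent (n ∸ 1) 0 (n ∸ 1)

    -- Placing the last vertex leaves `N` as the parent of the top end, which `finish` corrects, and
    -- writes pendant cells at `N + k`, just outside the tree.
    Written-finish : ∀ {s n} → Holds L s → n ≡ N → Written G ord (afterFinish s n)
    Written-finish {s} h refl = record
      { size-cell = refl ; root-cell = refl
      ; parent-top = write-same s₂ treeParent (suc k) 0 (suc k)
      ; parent-spine = λ i< → trans (write-row s₂ treeParent (suc k) 0 (suc k) (<⇒≢ i<))
          (parent-spine (≤-trans i< (≤-trans (n≤1+n _) (≤-reflexive (sym length≡)))))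
      ; parent-pendant = λ {j} j< → trans (write-row s₂ treeParent (suc k) 0 (suc k) (>⇒≢ (s≤s (s≤s (m≤m+n k j)))))
          (trans (cong (λ n → s treeParent (n + j) 0) (sym order≡))
            (parent-pendant (≤-trans (s≤s (s≤s (<⇒≤ j<))) (≤-reflexive (sym length≡)))))
      ; leaf-spine = λ i → leaf-spine (proj₂ (at i))
      ; leaf-pendant = λ j → trans (cong (λ n → s leafVertex (n + toℕ j) 0) (sym order≡))
          (leaf-pendant (subst (λ p → PlacedAt L (suc p) (proj₁ (at (suc (inject₁ j))))) (toℕ-inject₁ j) (proj₂ (at (suc (inject₁ j))))))
      }
      where
      open Holds h
      s₂ = write (write s treeSize 0 0 (N + k)) treeRoot 0 0 (suc k)

    finish-reaches : ∀ {s} → Holds L s → Reaches finish s 3 Result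
    finish-reaches {s} h = reach (seq assign (seq assign assign)) ≤-refl
      ( decomposition G ord
      , Written⇒Outputs G ord (Written-finish h (trans (Holds.order-cell h) order≡))
      , isCaterpillar , mim-bound)

  -- Running times

  module Timed (M : ℕ) (1≤M : 1 ≤ M) (order≤M : ∣ G ∣ ≤ M) (len≤M : ∀ e → len e ≤ M) where

    1≤M*M : 1 ≤ M * M
    1≤M*M = *-mono-≤ 1≤M 1≤M

    M≤M*M : M ≤ M * M
    M≤M*M = ≤-trans (≤-reflexive (sym (*-identityʳ M))) (*-monoʳ-≤ M 1≤M)

    scale : ∀ {x y} c → x ≤ y → c * x ≤ c * y
    scale c = *-monoʳ-≤ c

    visit-time : 2 + ∣ G ∣ * 9 ≤ 11 * M
    visit-time = ≤-trans (+-mono-≤ (scale 2 1≤M) (≤-trans (≤-reflexive (*-comm ∣ G ∣ 9)) (scale 9 order≤M)))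
      (≤-reflexive (sym (*-distribʳ-+ M 2 9)))

    edge-time : ∀ e → 1 + suc (len e * suc (2 + ∣ G ∣ * 9 + 1)) ≤ 15 * (M * M)
    edge-time e = ≤-trans (+-mono-≤ (scale 2 1≤M*M) (≤-trans (*-mono-≤ (len≤M e) iteration) (≤-reflexive M*13M)))
      (≤-reflexive (sym (*-distribʳ-+ (M * M) 2 13)))
      where
      iteration : suc (2 + ∣ G ∣ * 9 + 1) ≤ 13 * M
      iteration = ≤-trans (s≤s (+-monoˡ-≤ 1 visit-time)) (≤-trans (≤-reflexive (+-comm (suc (11 * M)) 1))
        (≤-trans (+-monoˡ-≤ (11 * M) (scale 2 1≤M)) (≤-reflexive (sym (*-distribʳ-+ M 2 11)))))
      M*13M : M * (13 * M) ≡ 13 * (M * M)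
      M*13M = trans (sym (*-assoc M 13 M)) (trans (cong (_* M) (*-comm M 13)) (*-assoc 13 M M))

    seq-scaled : ∀ {p q s Q R} T U → Reaches p s (T * (M * M)) Q → (∀ {s′} → Q s′ → Reaches q s′ (U * (M * M)) R) →
                 Reaches (p ⨟ q) s ((T + U) * (M * M)) R
    seq-scaled T U p q = reaches-weaken (≤-reflexive (sym (*-distribʳ-+ (M * M) T U))) (λ Rs → Rs) (reaches-seq p q)

    visitBranches-reaches : ∀ {s} bs → AllPairs (λ b b′ → inj₁ b ≼ inj₁ b′) bs → State 0 (BranchesLeft bs) s →
      Reaches (visitBranches bs) s (branchesCost bs * (M * M)) (State 0 (BranchesLeft []))
    visitBranches-reaches []       []         st = reach skip (≤-trans 1≤M*M (≤-reflexive (sym (*-identityˡ (M * M))))) st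
    visitBranches-reaches (b ∷ bs) (b≼ ∷ bs≼) st = seq-scaled 11 (branchesCost bs)
      (reaches-weaken (≤-trans visit-time (scale 11 M≤M*M)) (State-weaken λ {w} → left w)
        (visit-reaches _ 0 (BranchesLeft (b ∷ bs)) (inj₁ b) value (λ {w} → least w) st))
      (visitBranches-reaches bs bs≼)
      where
      value : ∀ {L s} → Holds L s → s index′ 0 0 ≡ 0 → s branchH′ (toℕ b) 0 ≡ toℕ (branch b)
      value h _ = trans (Holds.inputs h (m≤m+n 7 3) (toℕ b) 0) (array-toℕ (toℕ ∘ branch) b)
      least : ∀ w → BranchesLeft (b ∷ bs) w → inj₁ b ≼ w
      least (inj₁ _) (here refl) iso = iso , ≤-refl
      least (inj₁ _) (there b′∈)     = All.lookup b≼ b′∈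
      least (inj₂ _) _               = tt
      left : ∀ w → BranchesLeft (b ∷ bs) w × w ≢ inj₁ b → BranchesLeft bs w
      left (inj₁ _) (here refl , w≢b) = contradiction refl w≢b
      left (inj₁ _) (there b′∈ , _)   = b′∈
      left (inj₂ _) _                 = tt

    visitEdges-reaches : ∀ {s i} es → AllPairs (λ e e′ → toℕ e ≤ toℕ e′) es → State i (EdgesLeft es) s →
      Reaches (visitEdges es) s (edgesCost es * (M * M)) (λ s → ∃[ i ] State i (EdgesLeft []) s)
    visitEdges-reaches []       []         st = reach skip (≤-trans 1≤M*M (≤-reflexive (sym (*-identityˡ (M * M))))) (_ , st)
    visitEdges-reaches (e ∷ es) (e≤ ∷ es≤) st = seq-scaled 15 (edgesCost es)
      (reaches-weaken (edge-time e) (State-weaken λ {w} → leave w) (reaches-seq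
        (reach {Q = State 0 (InnerLeft e 0 es)} assign ≤-refl record
          { ordered = ordered ; holds = Holds-index holds ; at-index = refl
          ; remaining = λ {_} {w} v∉L v∋w → enter w (remaining v∉L v∋w) })
        (reaches-for (len e) (λ i → State i (InnerLeft e i es)) loop-guard step)))
      (visitEdges-reaches es es≤)
      where
      open State st
      enter : ∀ w → EdgesLeft (e ∷ es) w → InnerLeft e 0 es w
      enter (inj₂ _) e′∈ = e′∈ , λ _ → z≤n
      leave : ∀ w → InnerLeft e (len e) es w → EdgesLeft es w
      leave (inj₂ (_ , j)) (here refl , ≤j) = contradiction (≤j refl) (<⇒≱ (toℕ<n j))
      leave (inj₂ (_ , j)) (there e′∈ , _)  = e′∈
      loop-guard : ∀ {i s} → State i (InnerLeft e i es) s → s lenH′ (toℕ e) 0 ∸ s index′ 0 0 ≡ len e ∸ i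
      loop-guard st = cong₂ _∸_
        (trans (Holds.inputs (State.holds st) (m≤m+n 8 2) (toℕ e) 0) (array-toℕ len e)) (State.at-index st)
      iteration : ∀ {s} j → State (toℕ j) (InnerLeft e (toℕ j) es) s →
        Reaches (visit (innerH′ ⟨ lit (toℕ e) , cell index′ ⟩) ⨟ index′ ⟨ lit 0 , lit 0 ⟩≔ cell index′ ⊕ lit 1)
          s (2 + ∣ G ∣ * 9 + 1) (State (suc (toℕ j)) (InnerLeft e (suc (toℕ j)) es))
      iteration j st = reaches-seq
        (visit-reaches _ (toℕ j) (InnerLeft e (toℕ j) es) (inj₂ (e , j)) value (λ {w} → least w) st)
        (λ st → reach assign ≤-refl record
          { ordered = State.ordered st ; holds = Holds-index (State.holds st)
          ; at-index = trans (cong (_+ 1) (State.at-index st)) (+-comm (toℕ j) 1)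
          ; remaining = λ {_} {w} v∉L v∋w → left w (State.remaining st v∉L v∋w) })
        where
        value : ∀ {L s} → Holds L s → s index′ 0 0 ≡ toℕ j → s innerH′ (toℕ e) (s index′ 0 0) ≡ toℕ (inner e j)
        value {s = s} h eq = trans (cong (s innerH′ (toℕ e)) eq)
          (trans (Holds.inputs h (m≤m+n 9 1) (toℕ e) (toℕ j)) (trans (array-toℕ _ e) (array-toℕ _ j)))
        least : ∀ w → InnerLeft e (toℕ j) es w → inj₂ (e , j) ≼ w
        least (inj₂ _) (here refl , j≤) = ≤-refl , j≤
        least (inj₂ _) (there e′∈ , j≤) = All.lookup e≤ e′∈ , j≤
        left : ∀ w → InnerLeft e (toℕ j) es w × w ≢ inj₂ (e , j) → InnerLeft e (suc (toℕ j)) es w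
        left (inj₂ _) ((e′∈ , j≤) , w≢) = e′∈ , λ { refl → ≤∧≢⇒< (j≤ refl) λ eq → w≢ (cong (inj₂ ∘ (e ,_)) (toℕ-injective (sym eq))) }
      step : ∀ {i s} → i < len e → State i (InnerLeft e i es) s → Reaches _ s _ (State (suc i) (InnerLeft e (suc i) es))
      step {i} {s} i< st = subst (λ i → Reaches _ s _ (State (suc i) (InnerLeft e (suc i) es))) (toℕ-fromℕ< i<)
        (iteration (fromℕ< i<) (subst (λ i → State i (InnerLeft e i es) s) (sym (toℕ-fromℕ< i<)) st))

    finished : ∀ k → ∣ G ∣ ≡ suc (suc k) → ∀ {s} → (∃[ i ] State i (EdgesLeft []) s) →
      Reaches finish s (3 * (M * M)) Result
    finished k order≡ (_ , st) = reaches-weaken (scale 3 1≤M*M) (λ Rs → Rs)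
      (Final.finish-reaches k order≡ ordered complete holds)
      where
      open State st
      nothing-left : ∀ w → ¬ EdgesLeft [] w
      nothing-left (inj₁ _) ()
      nothing-left (inj₂ _) ()
      complete : ∀ v → v ∈ˡ L
      complete v with v ∈ˡ? L
      ... | yes v∈L = v∈L
      ... | no v∉L with bag-nonempty v
      ... | c , c∈ with Bijection.surjective vertices c
      ... | w , to≡ = contradiction (remaining v∉L (subst (λ c → c ∈ bag v) (sym (to≡ refl)) c∈)) (nothing-left w)

    program-reaches : 2 ≤ ∣ G ∣ →
      Reaches (program H) (input I) ((branchesCost (isolatedFirst H) + (edgesCost (allFin ‖ H ‖) + 3)) * (M * M)) Result
    program-reaches 2≤n = seq-scaled (branchesCost (isolatedFirst H)) (edgesCost (allFin ‖ H ‖) + 3)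
      (visitBranches-reaches _ isolatedFirst-sorted initial)
      (λ st → seq-scaled (edgesCost (allFin ‖ H ‖)) 3
        (visitEdges-reaches _ (AllPairs.tabulate⁺-< <⇒≤) (State-weaken (λ {w} → edges-left w) st))
        (finished (∣ G ∣ ∸ 2) (sym (m+[n∸m]≡n 2≤n))))
      where
      edges-left : ∀ w → BranchesLeft [] w → EdgesLeft (allFin ‖ H ‖) w
      edges-left (inj₂ (e , _)) _ = ∈-allFin e

theorem1 : (H : Graph) →
    ∃[ p ] SolvesInPolynomialTime {Instance H} p input inputSize
    (λ I → 2 ≤ ∣ Instance.G I ∣)
    (λ I s → ∃[ D ] (Outputs {Instance.G I} s D
    × IsCaterpillar (BranchDecomposition.tree D)
    × mimT D ≤ 1 ⊔ 2 * ‖ H ‖))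
theorem1 H = program H , c , 2 , λ I 2≤n → solves I (Correctness.Timed.program-reaches I (suc (inputSize I)) (s≤s z≤n)
    (m≤n⇒m≤1+n (Correctness.order≤size I)) (λ e → m≤n⇒m≤1+n (Correctness.len≤size I e)) 2≤n)
  where
  c = branchesCost (isolatedFirst H) + (edgesCost (allFin ‖ H ‖) + 3)
  solves : ∀ I {Q} → Reaches (program H) (input I) (c * (suc (inputSize I) * suc (inputSize I))) Q →
           ∃[ t ] ∃[ s ] (Run (program H) (input I) t s × t ≤ c * suc (inputSize I) ^ 2 × Q s)
  solves I (reach {t} {s} run t≤ result) = t , s , run ,
    -- The power `x ^ 2` unfolds to `x * (x * 1)`.
    subst (λ x → t ≤ c * (suc (inputSize I) * x)) (sym (*-identityʳ (suc (inputSize I)))) t≤ , result
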